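{- There exists an absolute constant $A > 0$ such that the following holds. Let $G = \mathbb{F}_2^n$ for some $n$, let $r$ be a positive integer, and suppose that $\alpha \colon G^4 \to \mathbb{F}_2$ is a multilinear form such that: (1) $\alpha$ is symmetric in the first 3 variables; (2) $\alpha(u,u,x_3,x_4) = 0$ for all $u, x_3, x_4 \in G$; (3) $\operatorname{prank}(\alpha + \alpha\circ(3\,\,4)) \leq r$. Then there exists a symmetric multilinear form $\alpha' \colon G^4 \to \mathbb{F}_2$ such that $\operatorname{prank}(\alpha + \alpha') \leq \exp(\exp(Ar))$.
   Context: For a multilinear form $\alpha \colon G^4 \to \mathbb{F}_2$, $\alpha\circ(3\,\,4)$ is the form $(x_1,x_2,x_3,x_4)\mapsto\alpha(x_1,x_2,x_4,x_3)$. A form is symmetric in a set of variables if it is invariant under all permutations of those variables, and symmetric if this holds for the set of all its variables. The partition rank $\operatorname{prank}\alpha$ of a multilinear form $\alpha \colon G^k \to \mathbb{F}_2$ is the least non-negative integer $m$ such that \[\alpha(x_1,\dots,x_k) = \sum_{i=1}^m \beta_i(x_j : j \in I_i)\,\gamma_i(x_j : j \in [k]\setminus I_i)\] for some sets $\emptyset \neq I_i \subsetneq [k]$ and multilinear forms $\beta_i \colon G^{I_i} \to \mathbb{F}_2$, $\gamma_i \colon G^{[k]\setminus I_i} \to \mathbb{F}_2$. -}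

module Defs where

open import Algebra.Bundles using (CommutativeRing)
import Algebra.Definitions.RawSemiring as RawSemiringDefs
import Algebra.Properties.Semiring.Sum as SemiringSum
open import Data.Bool.Base using (Bool; false; true; _∧_; _xor_)
open import Data.Bool.Properties using (xor-∧-commutativeRing)
open import Data.Fin.Base using (Fin; toℕ)
open import Data.Fin.Permutation using (Permutation′; _⟨$⟩ʳ_)
open import Data.Fin.Subset using (Subset; inside; outside; _∉_; _⊂_; Nonempty; ∣_∣; ∁; ⊤)
open import Data.Integer.Base using (+_)
open import Data.Nat.Base using (ℕ; suc; _≤_; _!)
open import Data.Nat.Properties using (_!≢0)
open import Data.Product.Base using (∃-syntax; Σ-syntax; _×_)
open import Data.Rational.Base as ℚ using (ℚ)
open import Data.Vec.Base using (Vec; []; _∷_; lookup; map; tabulate; zipWith; _[_]≔_)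
open import Relation.Binary.PropositionalEquality.Core using (_≡_)

𝔽₂ : Set
𝔽₂ = Bool

open CommutativeRing xor-∧-commutativeRing public
  using () renaming (_+_ to _+₂_; _*_ to _*₂_; 0# to 0₂)

open SemiringSum (CommutativeRing.semiring xor-∧-commutativeRing) public
  using () renaming (sum to sum₂)

G : ℕ → Set
G n = Vec 𝔽₂ n

infixl 6 _+ᴳ_ _⊕_
infixl 7 _·ᴳ_
infixl 7 _∘ₚ_

_+ᴳ_ : ∀ {n} → G n → G n → G n
_+ᴳ_ = zipWith _+₂_

_·ᴳ_ : ∀ {n} → 𝔽₂ → G n → G n
c ·ᴳ u = map (c *₂_) u

Form : ℕ → ℕ → Set
Form n k = Vec (G n) k → 𝔽₂

record Multilinear {n k} (α : Form n k) : Set where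
  field
    additive    : ∀ i xs u v →
                  α (xs [ i ]≔ (u +ᴳ v)) ≡ α (xs [ i ]≔ u) +₂ α (xs [ i ]≔ v)
    homogeneous : ∀ i xs c u →
                  α (xs [ i ]≔ (c ·ᴳ u)) ≡ c *₂ α (xs [ i ]≔ u)

_⊕_ : ∀ {n k} → Form n k → Form n k → Form n k
(α ⊕ β) xs = α xs +₂ β xs

_∘ₚ_ : ∀ {n k} → Form n k → Permutation′ k → Form n k
(α ∘ₚ π) xs = α (tabulate λ i → lookup xs (π ⟨$⟩ʳ i))

SymmetricIn : ∀ {n k} → Subset k → Form n k → Set
SymmetricIn S α = ∀ π → (∀ i → i ∉ S → π ⟨$⟩ʳ i ≡ i) → ∀ xs → (α ∘ₚ π) xs ≡ α xs

Symmetric : ∀ {n k} → Form n k → Set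
Symmetric = SymmetricIn ⊤

-- The subtuple (xⱼ : j ∈ I), listed in increasing order of j; this identifies
-- Gᴵ with the ∣ I ∣-tuples of elements of G.
restrict : ∀ {A : Set} {k} (I : Subset k) → Vec A k → Vec A ∣ I ∣
restrict []            []       = []
restrict (inside  ∷ I) (x ∷ xs) = x ∷ restrict I xs
restrict (outside ∷ I) (x ∷ xs) = restrict I xs

record SplitProduct (n k : ℕ) : Set where
  field
    I             : Subset k
    I-nonempty    : Nonempty I
    I-proper      : I ⊂ ⊤
    β             : Form n ∣ I ∣
    γ             : Form n ∣ ∁ I ∣
    β-multilinear : Multilinear β
    γ-multilinear : Multilinear γ

  form : Form n k
  form xs = β (restrict I xs) *₂ γ (restrict (∁ I) xs)

SumOfSplitProducts : ∀ {n k} → Form n k → ℕ → Set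
SumOfSplitProducts {n} {k} α m =
  Σ[ t ∈ (Fin m → SplitProduct n k) ]
    (∀ xs → α xs ≡ sum₂ (λ i → SplitProduct.form (t i) xs))

-- "prank α = m".
IsPrank : ∀ {n k} → Form n k → ℕ → Set
IsPrank α m = SumOfSplitProducts α m × (∀ m′ → SumOfSplitProducts α m′ → m ≤ m′)

-- A nondecreasing sequence of nonnegative rationals stands for its supremum,
-- a nonnegative real (or +∞).  All sequences formed by `const` and `exp` from
-- nonnegative rationals are of this kind.
ℝ⁺ : Set
ℝ⁺ = ℕ → ℚ

module ℚ-Ops = RawSemiringDefs ℚ.+-*-rawSemiring

-- The k-th term is the degree-k partial sum of the exponential series at the
-- k-th term of x.  These increase with k, and by monotone convergence their
-- supremum is the exponential of the supremum of x.
exp : ℝ⁺ → ℝ⁺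
exp x k = ℚ-Ops.sum {suc k} λ i → (x k ℚ-Ops.^ toℕ i) ℚ.* 1/! (toℕ i)
  where
  1/! : ℕ → ℚ
  1/! j = ((+ 1) ℚ./ (j !)) ⦃ j !≢0 ⦄

-- q ≤ sup x: every rational below q is below some term.
_≤ℝ_ : ℚ → ℝ⁺ → Set
q ≤ℝ x = ∀ p → p ℚ.< q → ∃[ k ] p ℚ.< x k

fromℕ : ℕ → ℚ
fromℕ m = (+ m) ℚ./ 1

-- Let ρ(x,y,z,w) = α(x,y,z,w) + α(x,y,w,z).  Composing α with a linear map that differs from the
-- identity by rank k changes it by partition rank at most 4k, so one may kill the functionals in
-- the 1|3 products of ρ and write ρ = A(xy;zw) + B(xz;yw) + C(xw;yz) with A, B, C in V ⊗ V for a
-- space V spanned by at most 2r bilinear forms; killing further functionals, all nonzero elements of V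
-- have large rank, so that the coefficients can be compared one pairing at a time.  Writing
-- [w] = α(x,y,z,w), the identity ρ = [w] + [z] makes ρ a 1-cocycle of S₄, whence B = C = Bᵀ and
-- A(xy;zw) = B(xy;zw) + B(xy;wz), and the invariance of A under x ↔ y puts B in V₀ ⊗ V + V ⊗ V₀,
-- where V₀ is the space of symmetric forms in V.  Finally ρ(w,u,w,u) = 0, which holds because α
-- is alternating, forces the diagonal of B to vanish.  Hence B = W + Wᵀ with W in V₀ ⊗ V, and
-- η = W(xy;zw) + W(xz;yw) + W(yz;xw) has low partition rank and makes α + η symmetric.  The
-- resulting bound is quadratic in r.

module Submission where

open import Defs
open import Algebra.Bundles using (CommutativeRing)
import Algebra.Properties.Semiring.Sum as SemiringSum
open import Data.Bool.Base using (Bool; true; false; _∧_; _∨_; _xor_; not)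
open import Data.Bool.Properties as Bool using (∧-assoc; ∧-comm; ∧-distribʳ-xor; ∧-distribˡ-xor; ∧-identityʳ; ∧-zeroʳ; xor-assoc; xor-comm; xor-identityʳ; xor-same; ¬-not)
open import Data.Bool.Solver using (module xor-∧-Solver)
open import Data.Fin using (#_)
open import Data.Fin.Base using (Fin; zero; suc; combine; inject≤; punchIn; punchOut; remQuot; splitAt; _↑ʳ_; _↑ˡ_)
open import Data.Fin.Permutation using (_⟨$⟩ʳ_; transpose)
open import Data.Fin.Permutation.Transposition.List using (TranspositionList; decompose; eval; eval-decompose)
open import Data.Fin.Properties using (all?; any?; punchIn-punchOut; punchInᵢ≢i; remQuot-combine; <-cmp; _<?_; _≟_)
open import Data.Fin.Subset using (Nonempty; Subset; inside; outside; ∁; ∣_∣; ⊤; _-_; _∈_; _⊂_)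
open import Data.Fin.Subset.Properties using (nonempty?; x∈p∧x≢y⇒x∈p-y; x∈p⇒∣p-x∣<∣p∣; ∈⊤; ∣p∣≤n; _⊂?_)
open import Data.Integer.Base as ℤ using (+_)
import Data.Integer.Properties as ℤ
open import Data.List.Base as List using (List; []; _∷_; length)
open import Data.List.Properties using (length-++)
open import Data.Nat.Base using (ℕ; zero; suc; z≤n; s≤s; >-nonZero; _+_; _*_; _<_; _≤_; _>_)
import Data.Nat.Properties as ℕ
open import Data.Nat.Properties using (+-mono-≤; m≤n⇒m<n∨m≡n; m≤n⇒m≤1+n; ≤-refl; ≤-reflexive; ≤-trans)
import Data.Nat.Solver as ℕ
open import Data.Product.Base using (Σ-syntax; ∃; ∃-syntax; proj₁; proj₂; _,_; _×_)
open import Data.Rational.Base as ℚ using (ℚ; 0ℚ; 1ℚ; ½)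
import Data.Rational.Properties as ℚ
import Data.Rational.Solver as ℚ
open import Data.Rational.Unnormalised.Base as ℚᵘ using (*≡*; mkℚᵘ)
import Data.Rational.Unnormalised.Properties as ℚᵘ
open import Data.Sum.Base using (inj₁; inj₂; _⊎_)
open import Data.Vec.Base as Vec using (Vec; []; _∷_; here; there; lookup; padRight; tabulate; _[_]≔_)
open import Data.Vec.Functional using (_++_)
open import Data.Vec.Functional.Properties using (lookup-++ˡ; lookup-++ʳ)
open import Data.Vec.Properties using (lookup∘tabulate; lookup⇒[]=; tabulate-cong; tabulate∘lookup; []=⇒lookup)
open import Function.Base using (const; id; _∘_)
open import Relation.Binary.Definitions using (tri<; tri≈; tri>)
open import Relation.Binary.PropositionalEquality using (_≡_; _≢_; refl; sym; trans; cong; cong₂; subst; module ≡-Reasoning)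
open import Relation.Nullary using (Dec; contradiction; does; no; yes; ¬_)
open import Relation.Nullary.Decidable using (True; dec-false; dec-true; map′; toWitness; _→-dec_; _×-dec_)

-- Comparing coefficients rests on one observation. With two of the four variables fixed, a pairing
-- that separates the two free ones is a function of rank at most d in them, where d is the number
-- of forms spanning V. So a combination of these forms that equals a sum of k such terms has rank
-- at most kd, and it must be the zero combination once ranks up to kd have been excluded. The
-- longest sum, in the cocycle identity, has six terms: this is the threshold K = 6d. K is chosen
-- for the initial d and kept, so each of the at most 2r eliminations costs 4K, whence the quadratic
-- bound. V₀ must be visible in the basis of V. Exchange steps put symmetric combinations into the
-- basis; they leave α alone and cost nothing. Over 𝔽₂ a symmetric matrix has the form W + Wᵀ
-- exactly when its diagonal vanishes, so the diagonal of B needs an argument of its own. For the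
-- rows of W to lie over V₀, the block of B with both indices off V₀ must vanish as well. The exact
-- partition rank is a minimum and the proof branches on the existence of relations; both are
-- settled by finite search.

private variable
  n : ℕ
  k : ℕ
  m : ℕ
  m′ : ℕ

-- Comparison of a quadratic bound with exp ∘ exp

toℚᵘ-fromℕ : ∀ m → ℚ.toℚᵘ (fromℕ m) ℚᵘ.≃ mkℚᵘ (+ m) 0
toℚᵘ-fromℕ m = ℚ.toℚᵘ-fromℚᵘ (mkℚᵘ (+ m) 0)

fromℕ-* : ∀ a b → fromℕ (a * b) ≡ fromℕ a ℚ.* fromℕ b
fromℕ-* a b = ℚ.toℚᵘ-injective (begin
  ℚ.toℚᵘ (fromℕ (a * b))                      ≈⟨ toℚᵘ-fromℕ (a * b) ⟩
  mkℚᵘ (+ (a * b)) 0                          ≈⟨ *≡* (cong (ℤ._* + 1) (ℤ.pos-* a b)) ⟩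
  mkℚᵘ (+ a) 0 ℚᵘ.* mkℚᵘ (+ b) 0              ≈⟨ ℚᵘ.≃-sym (ℚᵘ.*-cong (toℚᵘ-fromℕ a) (toℚᵘ-fromℕ b)) ⟩
  ℚ.toℚᵘ (fromℕ a) ℚᵘ.* ℚ.toℚᵘ (fromℕ b)      ≈⟨ ℚᵘ.≃-sym (ℚ.toℚᵘ-homo-* (fromℕ a) (fromℕ b)) ⟩
  ℚ.toℚᵘ (fromℕ a ℚ.* fromℕ b)                ∎)
  where open import Relation.Binary.Reasoning.Setoid ℚᵘ.≃-setoid

fromℕ-mono : ∀ {a b} → a ≤ b → fromℕ a ℚ.≤ fromℕ b
fromℕ-mono {a} {b} a≤b = ℚ.toℚᵘ-cancel-≤ (begin
  ℚ.toℚᵘ (fromℕ a)   ≃⟨ toℚᵘ-fromℕ a ⟩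
  mkℚᵘ (+ a) 0       ≤⟨ ℚᵘ.*≤* (ℤ.*-monoʳ-≤-nonNeg (+ 1) (ℤ.+≤+ a≤b)) ⟩
  mkℚᵘ (+ b) 0       ≃⟨ ℚᵘ.≃-sym (toℚᵘ-fromℕ b) ⟩
  ℚ.toℚᵘ (fromℕ b)   ∎)
  where open ℚᵘ.≤-Reasoning

exp-2 : ∀ x → exp x 2 ≡ 1ℚ ℚ.+ (x 2 ℚ.+ x 2 ℚ.* x 2 ℚ.* ½)
exp-2 x = solve 1 (λ a → con 1ℚ :* con 1ℚ :+ ((a :* con 1ℚ) :* con 1ℚ :+ ((a :* (a :* con 1ℚ)) :* con ½ :+ con 0ℚ)) :=
                         con 1ℚ :+ (a :+ a :* a :* con ½)) refl (x 2)
  where open ℚ.+-*-Solver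

nonNegative-square : ∀ a → 0ℚ ℚ.≤ a → 0ℚ ℚ.≤ a ℚ.* a ℚ.* ½
nonNegative-square a 0≤a = ℚ.nonNegative⁻¹ _
  {{ℚ.nonNeg*nonNeg⇒nonNeg (a ℚ.* a) {{ℚ.nonNeg*nonNeg⇒nonNeg a {{ℚ.nonNegative 0≤a}} a {{ℚ.nonNegative 0≤a}}}} ½}}

0≤1 : 0ℚ ℚ.≤ 1ℚ
0≤1 = ℚ.nonNegative⁻¹ 1ℚ

x≤exp : ∀ x → 0ℚ ℚ.≤ x 2 → x 2 ℚ.≤ exp x 2
x≤exp x 0≤x = begin
  x 2                                      ≡⟨ solve 1 (λ a → a := con 0ℚ :+ (a :+ con 0ℚ)) refl (x 2) ⟩
  0ℚ ℚ.+ (x 2 ℚ.+ 0ℚ)                      ≤⟨ ℚ.+-mono-≤ 0≤1 (ℚ.+-monoʳ-≤ (x 2) (nonNegative-square (x 2) 0≤x)) ⟩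
  1ℚ ℚ.+ (x 2 ℚ.+ x 2 ℚ.* x 2 ℚ.* ½)       ≡⟨ exp-2 x ⟨
  exp x 2                                  ∎
  where
  open ℚ.≤-Reasoning
  open ℚ.+-*-Solver

x²/2≤exp : ∀ x → 0ℚ ℚ.≤ x 2 → x 2 ℚ.* x 2 ℚ.* ½ ℚ.≤ exp x 2
x²/2≤exp x 0≤x = begin
  x 2 ℚ.* x 2 ℚ.* ½                        ≡⟨ solve 1 (λ b → b := con 0ℚ :+ (con 0ℚ :+ b)) refl (x 2 ℚ.* x 2 ℚ.* ½) ⟩
  0ℚ ℚ.+ (0ℚ ℚ.+ x 2 ℚ.* x 2 ℚ.* ½)        ≤⟨ ℚ.+-mono-≤ 0≤1 (ℚ.+-monoˡ-≤ (x 2 ℚ.* x 2 ℚ.* ½) 0≤x) ⟩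
  1ℚ ℚ.+ (x 2 ℚ.+ x 2 ℚ.* x 2 ℚ.* ½)       ≡⟨ exp-2 x ⟨
  exp x 2                                  ∎
  where
  open ℚ.≤-Reasoning
  open ℚ.+-*-Solver

-- Since 128 = 16²/2, the quadratic term of the inner exponential at 16r already reaches the bound,
-- and the outer exponential only has to dominate its argument. Index 2 is the first whose partial
-- sum contains that term.
quadratic≤exp-exp : ∀ {p} r → p ≤ 128 * (r * r) → fromℕ p ≤ℝ exp (exp (const (fromℕ 16 ℚ.* fromℕ r)))
quadratic≤exp-exp {p} r p≤ q q<p = 2 , ℚ.<-≤-trans q<p (begin
  fromℕ p                       ≤⟨ fromℕ-mono p≤ ⟩
  fromℕ (128 * (r * r))         ≡⟨ trans (fromℕ-* 128 (r * r)) (cong (fromℕ 128 ℚ.*_) (fromℕ-* r r)) ⟩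
  fromℕ 128 ℚ.* (fromℕ r ℚ.* fromℕ r)
    ≡⟨ solve 1 (λ a → con (fromℕ 128) :* (a :* a) := (con (fromℕ 16) :* a) :* (con (fromℕ 16) :* a) :* con ½) refl (fromℕ r) ⟩
  x ℚ.* x ℚ.* ½                 ≤⟨ x²/2≤exp (const x) 0≤x ⟩
  exp (const x) 2               ≤⟨ x≤exp (exp (const x)) (ℚ.≤-trans 0≤x (x≤exp (const x) 0≤x)) ⟩
  exp (exp (const x)) 2         ∎)
  where
  open ℚ.≤-Reasoning
  open ℚ.+-*-Solver
  x : ℚ
  x = fromℕ 16 ℚ.* fromℕ r
  0≤x : 0ℚ ℚ.≤ x
  0≤x = ℚ.≤-trans (fromℕ-mono {0} {16 * r} z≤n) (ℚ.≤-reflexive (fromℕ-* 16 r))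

-- On the left, `p * 4` pays for the linear factors of p split products, and each of the p + p
-- bilinear forms costs 4K + 3 with K = 6(p + p). Positivity of r absorbs the linear term 10p; 106
-- is rounded up to 128, half the square of 16.
bound : ∀ {p r} → r > 0 → p ≤ r → p * 4 + (p + p) * (6 * (p + p) * 4 + 3) ≤ 128 * (r * r)
bound {p} {r} r>0 p≤r = begin
  p * 4 + (p + p) * (6 * (p + p) * 4 + 3)
    ≡⟨ solve 1 (λ p → p :* con 4 :+ (p :+ p) :* ((con 6 :* (p :+ p)) :* con 4 :+ con 3) := con 96 :* (p :* p) :+ con 10 :* p) refl p ⟩
  96 * (p * p) + 10 * p
    ≤⟨ ℕ.+-mono-≤ (ℕ.*-monoʳ-≤ 96 (ℕ.*-mono-≤ p≤r p≤r)) (ℕ.*-monoʳ-≤ 10 (ℕ.≤-trans p≤r (ℕ.m≤n*m r r {{>-nonZero r>0}}))) ⟩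
  96 * (r * r) + 10 * (r * r)
    ≡⟨ solve 1 (λ s → con 96 :* s :+ con 10 :* s := con 106 :* s) refl (r * r) ⟩
  106 * (r * r)
    ≤⟨ ℕ.*-monoˡ-≤ (r * r) (ℕ.m≤m+n 106 22) ⟩
  128 * (r * r) ∎
  where
  open ℕ.≤-Reasoning
  open ℕ.+-*-Solver

open SemiringSum (CommutativeRing.semiring Bool.xor-∧-commutativeRing) using (sum-cong-≋; sum-remove; ∑-comm; ∑-distrib-+; *-distribˡ-sum)
open xor-∧-Solver

-- Linear algebra over 𝔽₂

xor≡false⇒≡ : ∀ {x y} → x xor y ≡ false → x ≡ y
xor≡false⇒≡ {true}  {true}  _ = refl
xor≡false⇒≡ {false} {false} _ = refl

≡⇒xor≡false : ∀ {x y} → x ≡ y → x xor y ≡ false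
≡⇒xor≡false {x} refl = xor-same x

infixl 7 _∙_

_∙_ : ∀ {d} → (Fin d → Bool) → (Fin d → Bool) → Bool
g ∙ h = sum₂ (λ i → g i ∧ h i)

∙-cong : ∀ {d} {g g′ h h′ : Fin d → Bool} → (∀ i → g i ≡ g′ i) → (∀ i → h i ≡ h′ i) → g ∙ h ≡ g′ ∙ h′
∙-cong p q = sum-cong-≋ (λ i → cong₂ _∧_ (p i) (q i))

∙-congˡ : ∀ {d} (g : Fin d → Bool) {h h′ : Fin d → Bool} → (∀ i → h i ≡ h′ i) → g ∙ h ≡ g ∙ h′
∙-congˡ g = ∙-cong (λ _ → refl)

∙-comm : ∀ {d} (g h : Fin d → Bool) → g ∙ h ≡ h ∙ g
∙-comm g h = sum-cong-≋ (λ i → ∧-comm (g i) (h i))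

∙-distribˡ : ∀ {d} (g h h′ : Fin d → Bool) → g ∙ (λ i → h i xor h′ i) ≡ g ∙ h xor g ∙ h′
∙-distribˡ g h h′ = trans (sum-cong-≋ (λ i → ∧-distribˡ-xor (g i) (h i) (h′ i))) (∑-distrib-+ (λ i → g i ∧ h i) (λ i → g i ∧ h′ i))

∙-distribʳ : ∀ {d} (g g′ h : Fin d → Bool) → (λ i → g i xor g′ i) ∙ h ≡ g ∙ h xor g′ ∙ h
∙-distribʳ g g′ h = trans (sum-cong-≋ (λ i → ∧-distribʳ-xor (h i) (g i) (g′ i))) (∑-distrib-+ (λ i → g i ∧ h i) (λ i → g′ i ∧ h i))

∙-scaleˡ : ∀ {d} c (g h : Fin d → Bool) → (λ i → c ∧ g i) ∙ h ≡ c ∧ g ∙ h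
∙-scaleˡ c g h = trans (sum-cong-≋ (λ i → ∧-assoc c (g i) (h i))) (sym (*-distribˡ-sum c (λ i → g i ∧ h i)))

sum₂-false : ∀ {d} {g : Fin d → Bool} → (∀ i → g i ≡ false) → sum₂ g ≡ false
sum₂-false {zero} p = refl
sum₂-false {suc d} p = cong₂ _xor_ (p zero) (sum₂-false (p ∘ suc))

∙-zeroˡ : ∀ {d} {g : Fin d → Bool} (h : Fin d → Bool) → (∀ i → g i ≡ false) → g ∙ h ≡ false
∙-zeroˡ h p = sum₂-false (λ i → cong (_∧ h i) (p i))

∙-zeroʳ : ∀ {d} (g : Fin d → Bool) {h : Fin d → Bool} → (∀ i → h i ≡ false) → g ∙ h ≡ false
∙-zeroʳ g p = trans (∙-comm g _) (∙-zeroˡ g p)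

∙-transpose : ∀ {d e} (g : Fin d → Bool) (A : Fin d → Fin e → Bool) (h : Fin e → Bool) →
              g ∙ (λ i → A i ∙ h) ≡ h ∙ (λ j → (λ i → A i j) ∙ g)
∙-transpose g A h = begin
  sum₂ (λ i → g i ∧ A i ∙ h)                       ≡⟨ sum-cong-≋ (λ i → *-distribˡ-sum (g i) (λ j → A i j ∧ h j)) ⟩
  sum₂ (λ i → sum₂ (λ j → g i ∧ (A i j ∧ h j)))    ≡⟨ ∑-comm (λ i j → g i ∧ (A i j ∧ h j)) ⟩
  sum₂ (λ j → sum₂ (λ i → g i ∧ (A i j ∧ h j)))    ≡⟨ sum-cong-≋ (λ j → sum-cong-≋ (λ i → rearrange (g i) (A i j) (h j))) ⟩
  sum₂ (λ j → sum₂ (λ i → h j ∧ (A i j ∧ g i)))    ≡⟨ sum-cong-≋ (λ j → sym (*-distribˡ-sum (h j) (λ i → A i j ∧ g i))) ⟩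
  sum₂ (λ j → h j ∧ (λ i → A i j) ∙ g)             ∎
  where
  open ≡-Reasoning
  rearrange : ∀ x a y → x ∧ (a ∧ y) ≡ y ∧ (a ∧ x)
  rearrange = solve 3 (λ x a y → x :* (a :* y) := y :* (a :* x)) refl

∙-remove : ∀ {d} (i : Fin (suc d)) (g h : Fin (suc d) → Bool) →
           g ∙ h ≡ g i ∧ h i xor (g ∘ punchIn i) ∙ (h ∘ punchIn i)
∙-remove i g h = sum-remove {i = i} (λ j → g j ∧ h j)

∙-++ : ∀ {d e} (g h : Fin d → Bool) (g′ h′ : Fin e → Bool) → (g ++ g′) ∙ (h ++ h′) ≡ g ∙ h xor g′ ∙ h′
∙-++ {zero}      g h g′ h′ = refl
∙-++ {suc d} {e} g h g′ h′ = trans (cong (g zero ∧ h zero xor_) (trans (∙-cong (shift g g′) (shift h h′)) (∙-++ (g ∘ suc) (h ∘ suc) g′ h′)))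
                                   (sym (xor-assoc (g zero ∧ h zero) _ _))
  where
  shift : (a : Fin (suc d) → Bool) (b : Fin e → Bool) → ∀ i → (a ++ b) (suc i) ≡ ((a ∘ suc) ++ b) i
  shift a b i with splitAt d i
  ... | inj₁ _ = refl
  ... | inj₂ _ = refl

unit : ∀ {d} → Fin d → Fin d → Bool
unit i j = does (i ≟ j)

unit-∙ : ∀ {d} (i : Fin d) (h : Fin d → Bool) → unit i ∙ h ≡ h i
unit-∙ {suc d} i h = begin
  unit i ∙ h                                                    ≡⟨ ∙-remove i (unit i) h ⟩
  unit i i ∧ h i xor (unit i ∘ punchIn i) ∙ (h ∘ punchIn i)     ≡⟨ cong₂ _xor_ (cong (_∧ h i) (dec-true (i ≟ i) refl))
                                                                    (∙-zeroˡ (h ∘ punchIn i) (λ j → dec-false (i ≟ punchIn i j) (punchInᵢ≢i i j ∘ sym))) ⟩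
  h i xor false                                                 ≡⟨ xor-identityʳ (h i) ⟩
  h i                                                           ∎
  where open ≡-Reasoning

infix 6 ⟨_∣_∣_⟩

-- The scalar gᵀAh. With values of a family v for g and h, it evaluates the element of V ⊗ V with
-- coefficient matrix A.
⟨_∣_∣_⟩ : ∀ {d e} → (Fin d → Bool) → (Fin d → Fin e → Bool) → (Fin e → Bool) → Bool
⟨ g ∣ A ∣ h ⟩ = g ∙ (λ i → A i ∙ h)

⟨⟩-zero : ∀ {d e} (g : Fin d → Bool) (h : Fin e → Bool) → ⟨ g ∣ (λ _ _ → false) ∣ h ⟩ ≡ false
⟨⟩-zero g h = ∙-zeroʳ g (λ i → ∙-zeroˡ h (λ _ → refl))

⟨⟩-+ : ∀ {d e} (g : Fin d → Bool) (A B : Fin d → Fin e → Bool) h →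
       ⟨ g ∣ (λ i j → A i j xor B i j) ∣ h ⟩ ≡ ⟨ g ∣ A ∣ h ⟩ xor ⟨ g ∣ B ∣ h ⟩
⟨⟩-+ g A B h = trans (∙-congˡ g (λ i → ∙-distribʳ (A i) (B i) h)) (∙-distribˡ g (λ i → A i ∙ h) (λ i → B i ∙ h))

⟨⟩-+ˡ : ∀ {d e} (g g′ : Fin d → Bool) (A : Fin d → Fin e → Bool) h →
       ⟨ (λ i → g i xor g′ i) ∣ A ∣ h ⟩ ≡ ⟨ g ∣ A ∣ h ⟩ xor ⟨ g′ ∣ A ∣ h ⟩
⟨⟩-+ˡ g g′ A h = ∙-distribʳ g g′ (λ i → A i ∙ h)

⟨⟩-+ʳ : ∀ {d e} (g : Fin d → Bool) (A : Fin d → Fin e → Bool) h h′ →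
       ⟨ g ∣ A ∣ (λ j → h j xor h′ j) ⟩ ≡ ⟨ g ∣ A ∣ h ⟩ xor ⟨ g ∣ A ∣ h′ ⟩
⟨⟩-+ʳ g A h h′ = trans (∙-congˡ g (λ i → ∙-distribˡ (A i) h h′)) (∙-distribˡ g (λ i → A i ∙ h) (λ i → A i ∙ h′))

⟨⟩-product : ∀ {d e} (c : Fin d → Bool) (c′ : Fin e → Bool) g h →
             ⟨ g ∣ (λ i j → c i ∧ c′ j) ∣ h ⟩ ≡ c ∙ g ∧ c′ ∙ h
⟨⟩-product c c′ g h = begin
  ⟨ g ∣ (λ i j → c i ∧ c′ j) ∣ h ⟩        ≡⟨ ∙-congˡ g (λ i → trans (∙-scaleˡ (c i) c′ h) (∧-comm (c i) _)) ⟩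
  g ∙ (λ i → c′ ∙ h ∧ c i)                ≡⟨ ∙-comm g _ ⟩
  (λ i → c′ ∙ h ∧ c i) ∙ g                ≡⟨ ∙-scaleˡ (c′ ∙ h) c g ⟩
  c′ ∙ h ∧ c ∙ g                          ≡⟨ ∧-comm (c′ ∙ h) _ ⟩
  c ∙ g ∧ c′ ∙ h                          ∎
  where open ≡-Reasoning

-- In characteristic 2 the off-diagonal terms of a symmetric matrix cancel in pairs.
⟨⟩-diagonal : ∀ {d} (B : Fin d → Fin d → Bool) → (∀ i j → B i j ≡ B j i) → ∀ t → ⟨ t ∣ B ∣ t ⟩ ≡ (λ i → B i i) ∙ t
⟨⟩-diagonal {zero}  B B-sym t = refl
⟨⟩-diagonal {suc d} B B-sym t = begin
  t₀ ∧ (B₀₀ ∧ t₀ xor row ∙ t′) xor t′ ∙ (λ i → B (suc i) zero ∧ t₀ xor (B (suc i) ∘ suc) ∙ t′)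
    ≡⟨ cong (t₀ ∧ (B₀₀ ∧ t₀ xor row ∙ t′) xor_) (∙-distribˡ t′ (λ i → B (suc i) zero ∧ t₀) (λ i → (B (suc i) ∘ suc) ∙ t′)) ⟩
  t₀ ∧ (B₀₀ ∧ t₀ xor row ∙ t′) xor (t′ ∙ (λ i → B (suc i) zero ∧ t₀) xor ⟨ t′ ∣ (λ i j → B (suc i) (suc j)) ∣ t′ ⟩)
    ≡⟨ cong₂ (λ x y → t₀ ∧ (B₀₀ ∧ t₀ xor row ∙ t′) xor (x xor y)) column (⟨⟩-diagonal (λ i j → B (suc i) (suc j)) (λ i j → B-sym (suc i) (suc j)) t′) ⟩
  t₀ ∧ (B₀₀ ∧ t₀ xor row ∙ t′) xor (t₀ ∧ row ∙ t′ xor (λ i → B (suc i) (suc i)) ∙ t′)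
    ≡⟨ lemma t₀ B₀₀ (row ∙ t′) _ ⟩
  B₀₀ ∧ t₀ xor (λ i → B (suc i) (suc i)) ∙ t′ ∎
  where
  open ≡-Reasoning
  t₀ = t zero
  t′ = t ∘ suc
  B₀₀ = B zero zero
  row = B zero ∘ suc
  column : t′ ∙ (λ i → B (suc i) zero ∧ t₀) ≡ t₀ ∧ row ∙ t′
  column = begin
    t′ ∙ (λ i → B (suc i) zero ∧ t₀)   ≡⟨ ∙-comm t′ _ ⟩
    (λ i → B (suc i) zero ∧ t₀) ∙ t′   ≡⟨ ∙-cong {h = t′} (λ i → trans (∧-comm _ t₀) (cong (t₀ ∧_) (B-sym (suc i) zero))) (λ _ → refl) ⟩
    (λ i → t₀ ∧ row i) ∙ t′            ≡⟨ ∙-scaleˡ t₀ row t′ ⟩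
    t₀ ∧ row ∙ t′                      ∎
  lemma : ∀ t b r s → t ∧ (b ∧ t xor r) xor (t ∧ r xor s) ≡ b ∧ t xor s
  lemma true  true  true  s = solve 1 (λ s → con false :+ (con true :+ s) := con true :+ s) refl s
  lemma true  true  false s = refl
  lemma true  false true  s = solve 1 (λ s → con true :+ (con true :+ s) := s) refl s
  lemma true  false false s = refl
  lemma false true r s = refl
  lemma false false r s = refl

-- Finite search

record Finite (A : Set) : Set where
  field
    size       : ℕ
    index      : A → Fin size
    elem       : Fin size → A
    elem-index : ∀ a → elem (index a) ≡ a

open Finite

finite-Bool : Finite Bool
finite-Bool .size = 2
finite-Bool .index false = zero
finite-Bool .index true  = suc zero
finite-Bool .elem zero       = false
finite-Bool .elem (suc zero) = true
finite-Bool .elem-index false = refl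
finite-Bool .elem-index true  = refl

finite-Vec : ∀ {A} → Finite A → Finite (Vec A k)
finite-Vec {zero}  F = record { size = 1 ; index = λ _ → zero ; elem = λ _ → [] ; elem-index = λ { [] → refl } }
finite-Vec {suc k} F = record
  { size       = size F * size Fᵏ
  ; index      = λ { (x ∷ xs) → combine (index F x) (index Fᵏ xs) }
  ; elem       = λ i → elem F (proj₁ (remQuot {size F} (size Fᵏ) i)) ∷ elem Fᵏ (proj₂ (remQuot {size F} (size Fᵏ) i))
  ; elem-index = λ { (x ∷ xs) → cong₂ _∷_
      (trans (cong (elem F ∘ proj₁) (remQuot-combine (index F x) (index Fᵏ xs))) (elem-index F x))
      (trans (cong (elem Fᵏ ∘ proj₂) (remQuot-combine (index F x) (index Fᵏ xs))) (elem-index Fᵏ xs)) }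
  }
  where Fᵏ = finite-Vec {k} F

-- The case distinctions that are not already decidable range over finite sets: whether a functional
-- vanishes, whether a relation among forms exists, whether m split products suffice. Deciding them
-- keeps the argument constructive.
∃? : ∀ {A} → Finite A → {P : A → Set} → (∀ a → Dec (P a)) → Dec (∃ P)
∃? F {P} P? = map′ (λ (i , p) → elem F i , p) (λ (a , p) → index F a , subst P (sym (elem-index F a)) p) (any? (P? ∘ elem F))

∀? : ∀ {A} → Finite A → {P : A → Set} → (∀ a → Dec (P a)) → Dec (∀ a → P a)
∀? F {P} P? = map′ (λ p a → subst P (elem-index F a) (p (index F a))) (λ p → p ∘ elem F) (all? (P? ∘ elem F))

finite-G : Finite (G n)
finite-G = finite-Vec finite-Bool

-- Without function extensionality P has to respect pointwise equality; f is coded by its table of values.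
∃-function? : ∀ {A} → Finite A → {P : (A → Bool) → Set} → (∀ {f g} → (∀ a → f a ≡ g a) → P f → P g) →
              (∀ f → Dec (P f)) → Dec (∃ P)
∃-function? F {P} P-resp P? = map′ (λ (t , p) → lookup t ∘ index F , p)
  (λ (f , p) → tabulate (f ∘ elem F) ,
     P-resp (λ a → sym (trans (lookup∘tabulate (f ∘ elem F) (index F a)) (cong f (elem-index F a)))) p)
  (∃? (finite-Vec finite-Bool) (λ t → P? (lookup t ∘ index F)))

-- Multilinear maps in curried form

Additive : (G n → G m) → Set
Additive f = ∀ u v → f (u +ᴳ v) ≡ f u +ᴳ f v

Linear : (G n → Bool) → Set
Linear f = ∀ u v → f (u +ᴳ v) ≡ f u xor f v

record Bilinear (φ : G n → G n → Bool) : Set where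
  field
    linearˡ : ∀ y → Linear (λ x → φ x y)
    linearʳ : ∀ x → Linear (φ x)

record Trilinear (τ : G n → G n → G n → Bool) : Set where
  field
    linear₁ : ∀ y z → Linear (λ x → τ x y z)
    linear₂ : ∀ x z → Linear (λ y → τ x y z)
    linear₃ : ∀ x y → Linear (λ z → τ x y z)

record Quadrilinear (q : G n → G n → G n → G n → Bool) : Set where
  field
    linear₁ : ∀ y z w → Linear (λ x → q x y z w)
    linear₂ : ∀ x z w → Linear (λ y → q x y z w)
    linear₃ : ∀ x y w → Linear (λ z → q x y z w)
    linear₄ : ∀ x y z → Linear (λ w → q x y z w)

open Bilinear
open Trilinear
open Quadrilinear

0ᴳ : G n
0ᴳ = Vec.replicate _ false

+ᴳ-self : (u : G n) → u +ᴳ u ≡ 0ᴳ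
+ᴳ-self []      = refl
+ᴳ-self (b ∷ u) = cong₂ _∷_ (xor-same b) (+ᴳ-self u)

+ᴳ-interchange : (a b c d : G n) → (a +ᴳ b) +ᴳ (c +ᴳ d) ≡ (a +ᴳ c) +ᴳ (b +ᴳ d)
+ᴳ-interchange []      []      []      []      = refl
+ᴳ-interchange (a ∷ u) (b ∷ v) (c ∷ w) (d ∷ x) =
  cong₂ _∷_ (solve 4 (λ a b c d → (a :+ b) :+ (c :+ d) := (a :+ c) :+ (b :+ d)) refl a b c d) (+ᴳ-interchange u v w x)

true-·ᴳ : (u : G n) → true ·ᴳ u ≡ u
true-·ᴳ []      = refl
true-·ᴳ (b ∷ u) = cong (b ∷_) (true-·ᴳ u)

false-·ᴳ : (u : G n) → false ·ᴳ u ≡ 0ᴳ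
false-·ᴳ []      = refl
false-·ᴳ (b ∷ u) = cong (false ∷_) (false-·ᴳ u)

xor-·ᴳ : ∀ a b (u : G n) → (a xor b) ·ᴳ u ≡ (a ·ᴳ u) +ᴳ (b ·ᴳ u)
xor-·ᴳ a b []      = refl
xor-·ᴳ a b (c ∷ u) = cong₂ _∷_ (∧-distribʳ-xor c a b) (xor-·ᴳ a b u)

linear-0 : {f : G n → Bool} → Linear f → f 0ᴳ ≡ false
linear-0 {f = f} f-lin = trans (cong f (sym (+ᴳ-self 0ᴳ))) (trans (f-lin 0ᴳ 0ᴳ) (xor-same (f 0ᴳ)))

linear-· : {f : G n → Bool} → Linear f → ∀ c u → f (c ·ᴳ u) ≡ c ∧ f u
linear-· {f = f} f-lin true  u = cong f (true-·ᴳ u)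
linear-· {f = f} f-lin false u = trans (cong f (false-·ᴳ u)) (linear-0 {f = f} f-lin)

additive⇒multilinear : {α : Form n k} →
  (∀ i xs u v → α (xs [ i ]≔ (u +ᴳ v)) ≡ α (xs [ i ]≔ u) xor α (xs [ i ]≔ v)) → Multilinear α
additive⇒multilinear {α = α} α-add = record
  { additive    = α-add
  ; homogeneous = λ i xs → linear-· {f = λ u → α (xs [ i ]≔ u)} (α-add i xs)
  }

curry₁ : Form n 1 → G n → Bool
curry₁ α x = α (x ∷ [])

curry₂ : Form n 2 → G n → G n → Bool
curry₂ α x y = α (x ∷ y ∷ [])

curry₄ : Form n 4 → G n → G n → G n → G n → Bool
curry₄ α x y z w = α (x ∷ y ∷ z ∷ w ∷ [])

form₁ : (G n → Bool) → Form n 1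
form₁ l (x ∷ []) = l x

form₂ : (G n → G n → Bool) → Form n 2
form₂ φ (x ∷ y ∷ []) = φ x y

form₃ : (G n → G n → G n → Bool) → Form n 3
form₃ τ (x ∷ y ∷ z ∷ []) = τ x y z

form₄ : (G n → G n → G n → G n → Bool) → Form n 4
form₄ q (x ∷ y ∷ z ∷ w ∷ []) = q x y z w

form₁-multilinear : {l : G n → Bool} → Linear l → Multilinear (form₁ l)
form₁-multilinear l-lin = additive⇒multilinear λ { zero (x ∷ []) → l-lin }

form₂-multilinear : {φ : G n → G n → Bool} → Bilinear φ → Multilinear (form₂ φ)
form₂-multilinear φ-lin = additive⇒multilinear λ
  { zero       (x ∷ y ∷ []) → linearˡ φ-lin y
  ; (suc zero) (x ∷ y ∷ []) → linearʳ φ-lin x }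

form₃-multilinear : {τ : G n → G n → G n → Bool} → Trilinear τ → Multilinear (form₃ τ)
form₃-multilinear τ-lin = additive⇒multilinear λ
  { zero             (x ∷ y ∷ z ∷ []) → linear₁ τ-lin y z
  ; (suc zero)       (x ∷ y ∷ z ∷ []) → linear₂ τ-lin x z
  ; (suc (suc zero)) (x ∷ y ∷ z ∷ []) → linear₃ τ-lin x y }

form₄-multilinear : {q : G n → G n → G n → G n → Bool} → Quadrilinear q → Multilinear (form₄ q)
form₄-multilinear q-lin = additive⇒multilinear λ
  { zero                   (x ∷ y ∷ z ∷ w ∷ []) → linear₁ q-lin y z w
  ; (suc zero)             (x ∷ y ∷ z ∷ w ∷ []) → linear₂ q-lin x z w
  ; (suc (suc zero))       (x ∷ y ∷ z ∷ w ∷ []) → linear₃ q-lin x y w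
  ; (suc (suc (suc zero))) (x ∷ y ∷ z ∷ w ∷ []) → linear₄ q-lin x y z }

open Multilinear

curry₁-linear : {α : Form n 1} → Multilinear α → Linear (curry₁ α)
curry₁-linear α-lin = additive α-lin zero (0ᴳ ∷ [])

curry₂-bilinear : {α : Form n 2} → Multilinear α → Bilinear (curry₂ α)
curry₂-bilinear α-lin .linearˡ y = additive α-lin zero (0ᴳ ∷ y ∷ [])
curry₂-bilinear α-lin .linearʳ x = additive α-lin (suc zero) (x ∷ 0ᴳ ∷ [])

curry₄-quadrilinear : {α : Form n 4} → Multilinear α → Quadrilinear (curry₄ α)
curry₄-quadrilinear α-lin .linear₁ y z w = additive α-lin zero (0ᴳ ∷ y ∷ z ∷ w ∷ [])
curry₄-quadrilinear α-lin .linear₂ x z w = additive α-lin (suc zero) (x ∷ 0ᴳ ∷ z ∷ w ∷ [])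
curry₄-quadrilinear α-lin .linear₃ x y w = additive α-lin (suc (suc zero)) (x ∷ y ∷ 0ᴳ ∷ w ∷ [])
curry₄-quadrilinear α-lin .linear₄ x y z = additive α-lin (suc (suc (suc zero))) (x ∷ y ∷ z ∷ 0ᴳ ∷ [])

open SplitProduct

-- Partition rank

total : List (SplitProduct n k) → Form n k
total []       xs = false
total (t ∷ ts) xs = form t xs xor total ts xs

total-++ : (ss ts : List (SplitProduct n k)) → ∀ xs → total (ss List.++ ts) xs ≡ total ss xs xor total ts xs
total-++ []       ts xs = refl
total-++ (s ∷ ss) ts xs = trans (cong (form s xs xor_) (total-++ ss ts xs)) (sym (xor-assoc (form s xs) (total ss xs) (total ts xs)))

-- Upper bounds are all that the argument manipulates, and lists make sums of decompositions
-- concatenations. The exact rank is recovered at the end by `prank-exists`.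
PrankAtMost : Form n k → ℕ → Set
PrankAtMost {n} {k} α m = Σ[ ts ∈ List (SplitProduct n k) ] length ts ≤ m × (∀ xs → α xs ≡ total ts xs)

prank-zero : {α : Form n k} → (∀ xs → α xs ≡ false) → PrankAtMost α 0
prank-zero α≡0 = [] , z≤n , α≡0

prank-form : (t : SplitProduct n k) → PrankAtMost (form t) 1
prank-form t = t ∷ [] , s≤s z≤n , λ xs → sym (xor-identityʳ (form t xs))

prank-cong : {α β : Form n k} → (∀ xs → α xs ≡ β xs) → PrankAtMost α m → PrankAtMost β m
prank-cong α≡β (ts , ts≤m , α≡ts) = ts , ts≤m , λ xs → trans (sym (α≡β xs)) (α≡ts xs)

prank-≤ : {α : Form n k} → m ≤ m′ → PrankAtMost α m → PrankAtMost α m′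
prank-≤ m≤m′ (ts , ts≤m , α≡ts) = ts , ≤-trans ts≤m m≤m′ , α≡ts

prank-⊕ : {α β : Form n k} → PrankAtMost α m → PrankAtMost β m′ → PrankAtMost (α ⊕ β) (m + m′)
prank-⊕ (ss , ss≤m , α≡ss) (ts , ts≤m′ , β≡ts) =
  ss List.++ ts , ≤-trans (≤-reflexive (length-++ ss)) (+-mono-≤ ss≤m ts≤m′) ,
  λ xs → trans (cong₂ _xor_ (α≡ss xs) (β≡ts xs)) (sym (total-++ ss ts xs))

prank-sum : ∀ {d} (αs : Fin d → Form n k) → (∀ i → PrankAtMost (αs i) 1) → PrankAtMost (λ xs → sum₂ (λ i → αs i xs)) d
prank-sum {d = zero}  αs p = prank-zero (λ _ → refl)
prank-sum {d = suc d} αs p = prank-⊕ (p zero) (prank-sum (αs ∘ suc) (p ∘ suc))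

sum₂-lookup : (ts : List (SplitProduct n k)) → ∀ xs → total ts xs ≡ sum₂ (λ i → form (List.lookup ts i) xs)
sum₂-lookup []       xs = refl
sum₂-lookup (t ∷ ts) xs = cong (form t xs xor_) (sum₂-lookup ts xs)

prank⇒sum : {α : Form n k} → PrankAtMost α m → ∃[ l ] (l ≤ m × SumOfSplitProducts α l)
prank⇒sum (ts , ts≤m , α≡ts) = length ts , ts≤m , List.lookup ts , λ xs → trans (α≡ts xs) (sum₂-lookup ts xs)

multilinear-cong : {α β : Form n k} → (∀ xs → α xs ≡ β xs) → Multilinear α → Multilinear β
multilinear-cong α≡β α-lin = additive⇒multilinear λ i xs u v →
  trans (sym (α≡β _)) (trans (additive α-lin i xs u v) (cong₂ _xor_ (α≡β _) (α≡β _)))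

multilinear? : (α : Form n k) → Dec (Multilinear α)
multilinear? α = map′ additive⇒multilinear additive
  (all? λ i → ∀? (finite-Vec finite-G) λ xs → ∀? finite-G λ u → ∀? finite-G λ v → _ Bool.≟ _)

IsSplitProduct : Form n k → Set
IsSplitProduct {n} {k} α = Σ[ t ∈ SplitProduct n k ] (∀ xs → form t xs ≡ α xs)

isSplitProduct? : (α : Form n k) → Dec (IsSplitProduct α)
isSplitProduct? {n} {k} α = map′ to from
  (∃? (finite-Vec finite-Bool) λ I → nonempty? I ×-dec (I ⊂? ⊤) ×-dec
    ∃-function? (finite-Vec finite-G) (Left-resp I) λ β → multilinear? β ×-dec
      ∃-function? (finite-Vec finite-G) (Right-resp I β) λ γ → multilinear? γ ×-dec
        ∀? (finite-Vec finite-G) λ xs → _ Bool.≟ _)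
  where
  Right : (I : Subset k) → Form n ∣ I ∣ → Form n ∣ ∁ I ∣ → Set
  Right I β γ = Multilinear γ × (∀ xs → β (restrict I xs) ∧ γ (restrict (∁ I) xs) ≡ α xs)
  Left : (I : Subset k) → Form n ∣ I ∣ → Set
  Left I β = Multilinear β × ∃ (Right I β)
  Right-resp : ∀ I β {γ γ′} → (∀ xs → γ xs ≡ γ′ xs) → Right I β γ → Right I β γ′
  Right-resp I β γ≡γ′ (γ-lin , eq) =
    multilinear-cong γ≡γ′ γ-lin , λ xs → trans (cong (β (restrict I xs) ∧_) (sym (γ≡γ′ _))) (eq xs)
  Left-resp : ∀ I {β β′} → (∀ xs → β xs ≡ β′ xs) → Left I β → Left I β′
  Left-resp I β≡β′ (β-lin , γ , γ-lin , eq) =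
    multilinear-cong β≡β′ β-lin , γ , γ-lin , λ xs → trans (cong (_∧ γ (restrict (∁ I) xs)) (sym (β≡β′ _))) (eq xs)
  to : ∃ (λ I → Nonempty I × I ⊂ ⊤ × ∃ (Left I)) → IsSplitProduct α
  to (I , ne , pr , β , β-lin , γ , γ-lin , eq) = record
    { I = I ; I-nonempty = ne ; I-proper = pr ; β = β ; γ = γ ; β-multilinear = β-lin ; γ-multilinear = γ-lin } , eq
  from : IsSplitProduct α → ∃ (λ I → Nonempty I × I ⊂ ⊤ × ∃ (Left I))
  from (t , eq) = I t , I-nonempty t , I-proper t , β t , β-multilinear t , γ t , γ-multilinear t , eq

-- Split products contain functions and proofs, so the search runs over m-tuples of value tables
-- instead and tests each table for being a split product.
sumOfSplitProducts? : (α : Form n k) → ∀ m → Dec (SumOfSplitProducts α m)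
sumOfSplitProducts? {n} {k} α m = map′ to from
  (∃? (finite-Vec (finite-Vec finite-Bool)) λ ts →
    all? (λ i → isSplitProduct? (decode ts i)) ×-dec ∀? (finite-Vec finite-G) λ xs → _ Bool.≟ _)
  where
  F : Finite (Vec (G n) k)
  F = finite-Vec finite-G
  decode : Vec (Vec Bool (size F)) m → Fin m → Form n k
  decode ts i xs = lookup (lookup ts i) (index F xs)
  Coded : Vec (Vec Bool (size F)) m → Set
  Coded ts = (∀ i → IsSplitProduct (decode ts i)) × (∀ xs → α xs ≡ sum₂ (λ i → decode ts i xs))
  to : ∃ Coded → SumOfSplitProducts α m
  to (ts , split , eq) = proj₁ ∘ split , λ xs → trans (eq xs) (sum-cong-≋ (λ i → sym (proj₂ (split i) xs)))
  from : SumOfSplitProducts α m → ∃ Coded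
  from (t , eq) = ts , (λ i → t i , decode-ts i) , λ xs → trans (eq xs) (sum-cong-≋ (λ i → decode-ts i xs))
    where
    ts = tabulate λ i → tabulate (form (t i) ∘ elem F)
    decode-ts : ∀ i xs → form (t i) xs ≡ decode ts i xs
    decode-ts i xs = sym (begin
      lookup (lookup ts i) (index F xs)                       ≡⟨ cong (λ v → lookup v (index F xs)) (lookup∘tabulate _ i) ⟩
      lookup (tabulate (form (t i) ∘ elem F)) (index F xs)    ≡⟨ lookup∘tabulate _ (index F xs) ⟩
      form (t i) (elem F (index F xs))                        ≡⟨ cong (form (t i)) (elem-index F xs) ⟩
      form (t i) xs                                           ∎)
      where open ≡-Reasoning

least : {P : ℕ → Set} → (∀ m → Dec (P m)) → ∀ {M} → P M → ∃[ m ] (m ≤ M × P m × (∀ m′ → P m′ → m ≤ m′))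
least {P} P? {M} pM with scan M
  where
  scan : ∀ M → (∃[ m ] (m ≤ M × P m × (∀ m′ → P m′ → m ≤ m′))) ⊎ (∀ m → P m → M < m)
  scan zero with P? zero
  ... | yes p0 = inj₁ (zero , z≤n , p0 , λ _ _ → z≤n)
  ... | no ¬p0 = inj₂ λ { zero p0 → contradiction p0 ¬p0 ; (suc m) _ → s≤s z≤n }
  scan (suc M) with scan M
  ... | inj₁ (m , m≤M , pm , min) = inj₁ (m , m≤n⇒m≤1+n m≤M , pm , min)
  ... | inj₂ none with P? (suc M)
  ...   | yes p  = inj₁ (suc M , ≤-refl , p , none)
  ...   | no ¬p = inj₂ λ m pm → larger m pm (m≤n⇒m<n∨m≡n (none m pm))
    where
    larger : ∀ m → P m → suc M < m ⊎ suc M ≡ m → suc M < m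
    larger m pm (inj₁ lt)   = lt
    larger m pm (inj₂ refl) = contradiction pm ¬p
... | inj₁ found = found
... | inj₂ none  = M , ≤-refl , pM , λ m pm → ≤-trans (m≤n⇒m≤1+n ≤-refl) (none m pm)

prank-exists : {α : Form n k} → PrankAtMost α m → ∃[ p ] (IsPrank α p × p ≤ m)
prank-exists {α = α} bound with prank⇒sum bound
... | l , l≤m , sum-l with least (sumOfSplitProducts? α) sum-l
...   | p , p≤l , sum-p , min = p , (sum-p , min) , ≤-trans p≤l l≤m

-- For bilinear φ this says that φ has rank at most K: its right kernel is cut out by K of
-- the functionals φ(x, ·).
Low : ℕ → (G n → G n → Bool) → Set
Low {n} K φ = Σ[ xs ∈ Vec (G n) K ] (∀ y → (∀ i → φ (lookup xs i) y ≡ false) → ∀ x → φ x y ≡ false)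

low? : ∀ K (φ : G n → G n → Bool) → Dec (Low K φ)
low? K φ = ∃? (finite-Vec finite-G) λ xs → ∀? finite-G λ y →
  all? (λ i → φ (lookup xs i) y Bool.≟ false) →-dec ∀? finite-G λ x → φ x y Bool.≟ false

lookup-padRight : ∀ {A : Set} {a : A} (m≤k : m ≤ k) (xs : Vec A m) i → lookup (padRight m≤k a xs) (inject≤ i m≤k) ≡ lookup xs i
lookup-padRight (s≤s m≤k) (x ∷ xs) zero    = refl
lookup-padRight (s≤s m≤k) (x ∷ xs) (suc i) = lookup-padRight m≤k xs i

low-≤ : ∀ {K} {φ : G n → G n → Bool} → m ≤ K → Low m φ → Low K φ
-- Further test vectors only strengthen the premise on `y`, so the padding may be arbitrary.
low-≤ {n} {φ = φ} m≤K (xs , det) = padRight m≤K 0ᴳ xs , λ y φy → det y λ i →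
  trans (cong (λ u → φ u y) (sym (lookup-padRight m≤K xs i))) (φy (inject≤ i m≤K))

low-cong : ∀ {K} {φ ψ : G n → G n → Bool} → (∀ x y → φ x y ≡ ψ x y) → Low K φ → Low K ψ
low-cong φ≡ψ (xs , det) = xs , λ y ψy x → trans (sym (φ≡ψ x y)) (det y (λ i → trans (φ≡ψ _ y) (ψy i)) x)

-- The rank of φ as a matrix indexed by G n: p and q need not be linear.
FunctionRank : ℕ → (G n → G n → Bool) → Set
FunctionRank {n} m φ = Σ[ p ∈ (G n → Fin m → Bool) ] Σ[ q ∈ (G n → Fin m → Bool) ] (∀ x y → φ x y ≡ p x ∙ q y)

functionRank-xor : {φ ψ : G n → G n → Bool} → FunctionRank m φ → FunctionRank m′ ψ →
                   FunctionRank (m + m′) (λ x y → φ x y xor ψ x y)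
functionRank-xor (p , q , φ≡) (p′ , q′ , ψ≡) =
  (λ x → p x ++ p′ x) , (λ y → q y ++ q′ y) ,
  λ x y → trans (cong₂ _xor_ (φ≡ x y) (ψ≡ x y)) (sym (∙-++ (p x) (q y) (p′ x) (q′ y)))

-- If p₀ x₀ = 1 then adding p₀(x) φ(x₀, y) to φ(x, y) eliminates q₀, as in Gaussian elimination.
functionRank⇒low : ∀ m {φ : G n → G n → Bool} → FunctionRank m φ → Low m φ
functionRank⇒low zero    (p , q , φ≡) = [] , λ y _ x → φ≡ x y
functionRank⇒low {n} (suc m) {φ} (p , q , φ≡) with ∃? finite-G (λ x → p x zero Bool.≟ true)
... | no ¬∃x₀ = 0ᴳ ∷ proj₁ rest , λ y φy → proj₂ rest y (φy ∘ suc)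
  where
  rest : Low m φ
  rest = functionRank⇒low m ((λ x → p x ∘ suc) , (λ y → q y ∘ suc) , λ x y →
    trans (φ≡ x y) (cong (λ b → b ∧ q y zero xor (p x ∘ suc) ∙ (q y ∘ suc)) (¬-not (λ px → ¬∃x₀ (x , px)))))
... | yes (x₀ , p₀x₀) = x₀ ∷ proj₁ rest , λ y φy x → begin
    φ x y                                 ≡⟨ sym (xor-identityʳ _) ⟩
    φ x y xor false                       ≡⟨ cong (φ x y xor_) (sym (trans (cong (p x zero ∧_) (φy zero)) (∧-zeroʳ _))) ⟩
    φ̃ x y                                 ≡⟨ proj₂ rest y (λ i → trans (cong₂ (λ a b → a xor p (lookup (proj₁ rest) i) zero ∧ b) (φy (suc i)) (φy zero)) (∧-zeroʳ (p (lookup (proj₁ rest) i) zero))) x ⟩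
    false                                 ∎
  where
  open ≡-Reasoning
  φ̃ : G n → G n → Bool
  φ̃ x y = φ x y xor p x zero ∧ φ x₀ y
  p̃ : G n → Fin m → Bool
  p̃ x i = p x (suc i) xor p x zero ∧ p x₀ (suc i)
  φ̃≡ : ∀ x y → φ̃ x y ≡ p̃ x ∙ (q y ∘ suc)
  φ̃≡ x y = begin
    φ x y xor p x zero ∧ φ x₀ y
      ≡⟨ cong₂ (λ a b → a xor p x zero ∧ b) (φ≡ x y) (trans (φ≡ x₀ y) (cong (λ c → c ∧ q y zero xor (p x₀ ∘ suc) ∙ (q y ∘ suc)) p₀x₀)) ⟩
    (p x zero ∧ q y zero xor (p x ∘ suc) ∙ (q y ∘ suc)) xor p x zero ∧ (q y zero xor (p x₀ ∘ suc) ∙ (q y ∘ suc))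
      ≡⟨ solve 4 (λ a b c d → (a :* b :+ c) :+ a :* (b :+ d) := c :+ a :* d) refl (p x zero) (q y zero) _ _ ⟩
    (p x ∘ suc) ∙ (q y ∘ suc) xor p x zero ∧ (p x₀ ∘ suc) ∙ (q y ∘ suc)
      ≡⟨ cong ((p x ∘ suc) ∙ (q y ∘ suc) xor_) (sym (∙-scaleˡ (p x zero) (p x₀ ∘ suc) (q y ∘ suc))) ⟩
    (p x ∘ suc) ∙ (q y ∘ suc) xor (λ i → p x zero ∧ p x₀ (suc i)) ∙ (q y ∘ suc)
      ≡⟨ sym (∙-distribʳ (p x ∘ suc) (λ i → p x zero ∧ p x₀ (suc i)) (q y ∘ suc)) ⟩
    p̃ x ∙ (q y ∘ suc) ∎
  rest : Low m φ̃
  rest = functionRank⇒low m (p̃ , (λ y → q y ∘ suc) , φ̃≡)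

-- The source of all rank bounds below: a pairing that separates the two free variables has this
-- form once the other two are fixed.
functionRank-⟨⟩ : ∀ {d e} (g : G n → Fin d → Bool) (A : Fin d → Fin e → Bool) (h : G n → Fin e → Bool) →
                  FunctionRank d (λ x y → ⟨ g x ∣ A ∣ h y ⟩)
functionRank-⟨⟩ g A h = g , (λ y i → A i ∙ h y) , λ _ _ → refl

-- Partition rank of forms in four variables

Form₄ : ℕ → Set
Form₄ n = G n → G n → G n → G n → Bool

infixl 6 _⊞_

_⊞_ : Form₄ n → Form₄ n → Form₄ n
(q ⊞ q′) x y z w = q x y z w xor q′ x y z w

PrankAtMost₄ : Form₄ n → ℕ → Set
PrankAtMost₄ q = PrankAtMost (form₄ q)

prank₄-cong : {q q′ : Form₄ n} → (∀ x y z w → q x y z w ≡ q′ x y z w) → PrankAtMost₄ q m → PrankAtMost₄ q′ m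
prank₄-cong q≡q′ = prank-cong λ { (x ∷ y ∷ z ∷ w ∷ []) → q≡q′ x y z w }

prank₄-⊞ : {q q′ : Form₄ n} → PrankAtMost₄ q m → PrankAtMost₄ q′ m′ → PrankAtMost₄ (q ⊞ q′) (m + m′)
prank₄-⊞ p p′ = prank-cong (λ { (x ∷ y ∷ z ∷ w ∷ []) → refl }) (prank-⊕ p p′)

prank₄-trans : (q q′ q″ : Form₄ n) → PrankAtMost₄ (q ⊞ q′) m → PrankAtMost₄ (q′ ⊞ q″) m′ → PrankAtMost₄ (q ⊞ q″) (m + m′)
prank₄-trans q q′ q″ p p′ = prank₄-cong
  (λ x y z w → solve 3 (λ a b c → (a :+ b) :+ (b :+ c) := a :+ c) refl (q x y z w) (q′ x y z w) (q″ x y z w))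
  (prank₄-⊞ p p′)

prank₄-sum : ∀ {d} (qs : Fin d → Form₄ n) → (∀ i → PrankAtMost₄ (qs i) 1) → PrankAtMost₄ (λ x y z w → sum₂ (λ i → qs i x y z w)) d
prank₄-sum {d = d} qs p = prank-cong (λ { (x ∷ y ∷ z ∷ w ∷ []) → refl }) (prank-sum (λ i → form₄ (qs i)) p)

prank-split : (I : Subset 4) {_ : True (nonempty? I)} {_ : True (I ⊂? ⊤)} {β : Form n ∣ I ∣} {γ : Form n ∣ ∁ I ∣} →
              Multilinear β → Multilinear γ → PrankAtMost (λ xs → β (restrict I xs) ∧ γ (restrict (∁ I) xs)) 1
prank-split I {ne} {pr} {β} {γ} β-lin γ-lin = prank-form record
  { I = I ; I-nonempty = toWitness ne ; I-proper = toWitness pr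
  ; β = β ; γ = γ ; β-multilinear = β-lin ; γ-multilinear = γ-lin }

module _ {l : G n → Bool} {τ : G n → G n → G n → Bool} (l-lin : Linear l) (τ-lin : Trilinear τ) where

  prank-1∣234 : PrankAtMost₄ (λ x y z w → l x ∧ τ y z w) 1
  prank-1∣234 = prank-cong (λ { (x ∷ y ∷ z ∷ w ∷ []) → refl })
    (prank-split (inside ∷ outside ∷ outside ∷ outside ∷ []) (form₁-multilinear l-lin) (form₃-multilinear τ-lin))

  prank-2∣134 : PrankAtMost₄ (λ x y z w → l y ∧ τ x z w) 1
  prank-2∣134 = prank-cong (λ { (x ∷ y ∷ z ∷ w ∷ []) → refl })
    (prank-split (outside ∷ inside ∷ outside ∷ outside ∷ []) (form₁-multilinear l-lin) (form₃-multilinear τ-lin))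

  prank-3∣124 : PrankAtMost₄ (λ x y z w → l z ∧ τ x y w) 1
  prank-3∣124 = prank-cong (λ { (x ∷ y ∷ z ∷ w ∷ []) → refl })
    (prank-split (outside ∷ outside ∷ inside ∷ outside ∷ []) (form₁-multilinear l-lin) (form₃-multilinear τ-lin))

  prank-4∣123 : PrankAtMost₄ (λ x y z w → l w ∧ τ x y z) 1
  prank-4∣123 = prank-cong (λ { (x ∷ y ∷ z ∷ w ∷ []) → refl })
    (prank-split (outside ∷ outside ∷ outside ∷ inside ∷ []) (form₁-multilinear l-lin) (form₃-multilinear τ-lin))

module _ {φ ψ : G n → G n → Bool} (φ-lin : Bilinear φ) (ψ-lin : Bilinear ψ) where

  prank-12∣34 : PrankAtMost₄ (λ x y z w → φ x y ∧ ψ z w) 1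
  prank-12∣34 = prank-cong (λ { (x ∷ y ∷ z ∷ w ∷ []) → refl })
    (prank-split (inside ∷ inside ∷ outside ∷ outside ∷ []) (form₂-multilinear φ-lin) (form₂-multilinear ψ-lin))

  prank-13∣24 : PrankAtMost₄ (λ x y z w → φ x z ∧ ψ y w) 1
  prank-13∣24 = prank-cong (λ { (x ∷ y ∷ z ∷ w ∷ []) → refl })
    (prank-split (inside ∷ outside ∷ inside ∷ outside ∷ []) (form₂-multilinear φ-lin) (form₂-multilinear ψ-lin))

  prank-23∣14 : PrankAtMost₄ (λ x y z w → φ y z ∧ ψ x w) 1
  prank-23∣14 = prank-cong (λ { (x ∷ y ∷ z ∷ w ∷ []) → refl })
    (prank-split (outside ∷ inside ∷ inside ∷ outside ∷ []) (form₂-multilinear φ-lin) (form₂-multilinear ψ-lin))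

linear-∘ : {f : G n → Bool} {P : G n → G n} → Additive P → Linear f → Linear (f ∘ P)
linear-∘ {f = f} P-add f-lin u v = trans (cong f (P-add u v)) (f-lin _ _)

bilinear-∘ : {φ : G n → G n → Bool} {P : G n → G n} → Additive P → Bilinear φ → Bilinear (λ x y → φ (P x) (P y))
bilinear-∘ {φ = φ} {P} P-add φ-lin .linearˡ y = linear-∘ {f = λ x → φ x (P y)} P-add (linearˡ φ-lin (P y))
bilinear-∘ {φ = φ} {P} P-add φ-lin .linearʳ x = linear-∘ {f = φ (P x)} P-add (linearʳ φ-lin (P x))

infixl 7 _∘₄_

_∘₄_ : Form₄ n → (G n → G n) → Form₄ n
(q ∘₄ P) x y z w = q (P x) (P y) (P z) (P w)

quadrilinear-∘ : {q : Form₄ n} {P : G n → G n} → Additive P → Quadrilinear q → Quadrilinear (q ∘₄ P)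
quadrilinear-∘ {q = q} {P} P-add q-lin .linear₁ y z w = linear-∘ {f = λ x → q x (P y) (P z) (P w)} P-add (linear₁ q-lin _ _ _)
quadrilinear-∘ {q = q} {P} P-add q-lin .linear₂ x z w = linear-∘ {f = λ y → q (P x) y (P z) (P w)} P-add (linear₂ q-lin _ _ _)
quadrilinear-∘ {q = q} {P} P-add q-lin .linear₃ x y w = linear-∘ {f = λ z → q (P x) (P y) z (P w)} P-add (linear₃ q-lin _ _ _)
quadrilinear-∘ {q = q} {P} P-add q-lin .linear₄ x y z = linear-∘ {f = λ w → q (P x) (P y) (P z) w} P-add (linear₄ q-lin _ _ _)

linear-xor : (f g : G n → Bool) → Linear f → Linear g → Linear (λ u → f u xor g u)
linear-xor f g f-lin g-lin u v = trans (cong₂ _xor_ (f-lin u v) (g-lin u v))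
  (solve 4 (λ a b c d → (a :+ b) :+ (c :+ d) := (a :+ c) :+ (b :+ d)) refl (f u) (f v) (g u) (g v))

quadrilinear-⊞ : {q q′ : Form₄ n} → Quadrilinear q → Quadrilinear q′ → Quadrilinear (q ⊞ q′)
quadrilinear-⊞ {q = q} {q′} q-lin q′-lin = record
  { linear₁ = λ y z w → linear-xor (λ x → q x y z w) (λ x → q′ x y z w) (linear₁ q-lin y z w) (linear₁ q′-lin y z w)
  ; linear₂ = λ x z w → linear-xor (λ y → q x y z w) (λ y → q′ x y z w) (linear₂ q-lin x z w) (linear₂ q′-lin x z w)
  ; linear₃ = λ x y w → linear-xor (λ z → q x y z w) (λ z → q′ x y z w) (linear₃ q-lin x y w) (linear₃ q′-lin x y w)
  ; linear₄ = λ x y z → linear-xor (q x y z) (q′ x y z) (linear₄ q-lin x y z) (linear₄ q′-lin x y z)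
  }

-- Killing linear functionals

module Elementary {n} (l : G n → Bool) (l-lin : Linear l) (e : G n) (l-e : l e ≡ true) where

  -- The projection onto the kernel of `l` along `e`.
  E : G n → G n
  E x = x +ᴳ (l x ·ᴳ e)

  E-additive : Additive E
  E-additive u v = trans (cong ((u +ᴳ v) +ᴳ_) (trans (cong (_·ᴳ e) (l-lin u v)) (xor-·ᴳ (l u) (l v) e)))
                         (+ᴳ-interchange u v (l u ·ᴳ e) (l v ·ᴳ e))

  linear-E : {f : G n → Bool} → Linear f → ∀ x → f (E x) ≡ f x xor l x ∧ f e
  linear-E {f} f-lin x = trans (f-lin x (l x ·ᴳ e)) (cong (f x xor_) (linear-· {f = f} f-lin (l x) e))

  l-E : ∀ x → l (E x) ≡ false
  l-E x = trans (linear-E {l} l-lin x) (trans (cong (λ b → l x xor l x ∧ b) l-e)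
                (trans (cong (l x xor_) (∧-identityʳ (l x))) (xor-same (l x))))

  -- Applying `E` to one argument at a time changes the form by `l` of that argument times a
  -- trilinear form in the other three, so four 1|3 products account for the whole difference.
  prank-E : {q : Form₄ n} → Quadrilinear q → PrankAtMost₄ (q ⊞ q ∘₄ E) 4
  prank-E {q} q-lin = prank₄-cong (λ x y z w → sym (telescope x y z w))
    (prank₄-⊞ (prank-1∣234 {l = l} l-lin T₁) (prank₄-⊞ (prank-2∣134 {l = l} l-lin T₂) (prank₄-⊞ (prank-3∣124 {l = l} l-lin T₃) (prank-4∣123 {l = l} l-lin T₄))))
    where
    T₁ : Trilinear (λ y z w → q e (E y) (E z) (E w))
    T₁ .linear₁ z w = linear-∘ {f = λ y → q e y (E z) (E w)} E-additive (linear₂ q-lin _ _ _)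
    T₁ .linear₂ y w = linear-∘ {f = λ z → q e (E y) z (E w)} E-additive (linear₃ q-lin _ _ _)
    T₁ .linear₃ y z = linear-∘ {f = λ w → q e (E y) (E z) w} E-additive (linear₄ q-lin _ _ _)
    T₂ : Trilinear (λ x z w → q x e (E z) (E w))
    T₂ .linear₁ z w = linear₁ q-lin _ _ _
    T₂ .linear₂ x w = linear-∘ {f = λ z → q x e z (E w)} E-additive (linear₃ q-lin _ _ _)
    T₂ .linear₃ x z = linear-∘ {f = λ w → q x e (E z) w} E-additive (linear₄ q-lin _ _ _)
    T₃ : Trilinear (λ x y w → q x y e (E w))
    T₃ .linear₁ y w = linear₁ q-lin _ _ _
    T₃ .linear₂ x w = linear₂ q-lin _ _ _
    T₃ .linear₃ x y = linear-∘ {f = λ w → q x y e w} E-additive (linear₄ q-lin _ _ _)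
    T₄ : Trilinear (λ x y z → q x y z e)
    T₄ .linear₁ y z = linear₁ q-lin _ _ _
    T₄ .linear₂ x z = linear₂ q-lin _ _ _
    T₄ .linear₃ x y = linear₃ q-lin _ _ _
    telescope : ∀ x y z w → q x y z w xor q (E x) (E y) (E z) (E w) ≡
      l x ∧ q e (E y) (E z) (E w) xor (l y ∧ q x e (E z) (E w) xor (l z ∧ q x y e (E w) xor l w ∧ q x y z e))
    telescope x y z w = trans (cong (q x y z w xor_)
      (trans (linear-E {λ x → q x (E y) (E z) (E w)} (linear₁ q-lin _ _ _) x)
      (cong (_xor l x ∧ q e (E y) (E z) (E w)) (trans (linear-E {λ y → q x y (E z) (E w)} (linear₂ q-lin _ _ _) y)
      (cong (_xor l y ∧ q x e (E z) (E w)) (trans (linear-E {λ z → q x y z (E w)} (linear₃ q-lin _ _ _) z)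
      (cong (_xor l z ∧ q x y e (E w)) (linear-E {λ w → q x y z w} (linear₄ q-lin _ _ _) w))))))))
      (solve 5 (λ q a b c d → q :+ ((((q :+ d) :+ c) :+ b) :+ a) := a :+ (b :+ (c :+ d))) refl
        (q x y z w) (l x ∧ q e (E y) (E z) (E w)) (l y ∧ q x e (E z) (E w)) (l z ∧ q x y e (E w)) (l w ∧ q x y z e))

record Annihilator (ls : Fin k → G n → Bool) : Set where
  field
    P           : G n → G n
    P-additive  : Additive P
    annihilates : ∀ i x → ls i (P x) ≡ false
    prank-P     : ∀ {q : Form₄ n} → Quadrilinear q → PrankAtMost₄ (q ⊞ q ∘₄ P) (k * 4)

open Annihilator

annihilator : ∀ k (ls : Fin k → G n → Bool) → (∀ i → Linear (ls i)) → Annihilator ls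
annihilator zero ls ls-lin = record
  { P = id ; P-additive = λ _ _ → refl ; annihilates = λ ()
  ; prank-P = λ {q} _ → prank-zero λ { (x ∷ y ∷ z ∷ w ∷ []) → xor-same (q x y z w) } }
annihilator {n} (suc k) ls ls-lin with annihilator k (ls ∘ suc) (ls-lin ∘ suc)
... | R with ∃? finite-G (λ e → ls zero (P R e) Bool.≟ true)
...   | no ¬∃e = record
  { P = P R ; P-additive = P-additive R
  ; annihilates = λ { zero x → ¬-not (λ lx → ¬∃e (x , lx)) ; (suc i) x → annihilates R i x }
  ; prank-P = λ q-lin → prank-≤ (ℕ.m≤n+m (k * 4) 4) (prank-P R q-lin) }
...   | yes (e , l-e) = record
  -- The functionals killed earlier vanish on the image of `P R`, which contains the image of the
  -- composite; only the new one calls for `E`.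
  { P = P R ∘ E
  ; P-additive = λ u v → trans (cong (P R) (E-additive u v)) (P-additive R (E u) (E v))
  ; annihilates = λ { zero x → l-E x ; (suc i) x → annihilates R i (E x) }
  ; prank-P = λ {q} q-lin → prank-≤ (ℕ.≤-reflexive (ℕ.+-comm (k * 4) 4))
      (prank₄-trans q (q ∘₄ P R) (q ∘₄ (P R ∘ E)) (prank-P R q-lin) (prank-E (quadrilinear-∘ (P-additive R) q-lin))) }
  where
  open Elementary (ls zero ∘ P R) (linear-∘ {f = ls zero} (P-additive R) (ls-lin zero)) e l-e

-- Split products in four variables: 1|3 and 2|2

data Pairing : Set where
  12∣34 13∣24 14∣23 : Pairing

arrange : Pairing → (φ ψ : G n → G n → Bool) → Form₄ n
arrange 12∣34 φ ψ x y z w = φ x y ∧ ψ z w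
arrange 13∣24 φ ψ x y z w = φ x z ∧ ψ y w
arrange 14∣23 φ ψ x y z w = φ x w ∧ ψ y z

-- One format for both kinds of split product: a 1|3 product has its linear factor as `l` and zero
-- for `φ` and `ψ`, a 2|2 product has `l` zero. Every product thus contributes one functional to
-- kill and two bilinear forms.
record Shape (f : Form₄ n) : Set where
  field
    l       : G n → Bool
    l-lin   : Linear l
    pairing : Pairing
    φ ψ     : G n → G n → Bool
    φ-lin   : Bilinear φ
    ψ-lin   : Bilinear ψ
    shape   : ∀ x y z w → l x ≡ false → l y ≡ false → l z ≡ false → l w ≡ false →
              f x y z w ≡ arrange pairing φ ψ x y z w

shapeˡ : {l : G n → Bool} {f : Form₄ n} → Linear l →
         (∀ x y z w → l x ≡ false → l y ≡ false → l z ≡ false → l w ≡ false → f x y z w ≡ false) → Shape f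
shapeˡ {l = l} l-lin f≡0 = record
  { l = l ; l-lin = l-lin ; pairing = 12∣34 ; φ = λ _ _ → false ; ψ = λ _ _ → false
  ; φ-lin = zero-lin ; ψ-lin = zero-lin ; shape = f≡0 }
  where
  zero-lin : Bilinear (λ (_ _ : G _) → false)
  zero-lin = record { linearˡ = λ _ _ _ → refl ; linearʳ = λ _ _ _ → refl }

shapeᵖ : {f : Form₄ n} (p : Pairing) {φ ψ : G n → G n → Bool} → Bilinear φ → Bilinear ψ →
         (∀ x y z w → f x y z w ≡ arrange p φ ψ x y z w) → Shape f
shapeᵖ p {φ} {ψ} φ-lin ψ-lin f≡ = record
  { l = λ _ → false ; l-lin = λ _ _ → refl ; pairing = p ; φ = φ ; ψ = ψ
  ; φ-lin = φ-lin ; ψ-lin = ψ-lin ; shape = λ x y z w _ _ _ _ → f≡ x y z w }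

∧-falseˡ : ∀ {a} b → a ≡ false → a ∧ b ≡ false
∧-falseˡ b refl = refl

∧-falseʳ : ∀ a {b} → b ≡ false → a ∧ b ≡ false
∧-falseʳ a refl = ∧-zeroʳ a

classify : (t : SplitProduct n 4) → Shape (curry₄ (form t))
classify {n} t = go (I t) (I-nonempty t) (I-proper t) (β t) (γ t) (β-multilinear t) (γ-multilinear t)
  where
  go : (I : Subset 4) → Nonempty I → I ⊂ ⊤ → (β : Form n ∣ I ∣) (γ : Form n ∣ ∁ I ∣) → Multilinear β → Multilinear γ →
       Shape (curry₄ (λ xs → β (restrict I xs) ∧ γ (restrict (∁ I) xs)))
  go (false ∷ false ∷ false ∷ false ∷ []) (_ , there (there (there (there ())))) _ _ _ _ _
  go (true ∷ true ∷ true ∷ true ∷ []) _ (_ , i , _ , i∉) _ _ _ _ = contradiction ∈⊤ i∉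
  go (true ∷ false ∷ false ∷ false ∷ []) _ _ β γ b c = shapeˡ {l = curry₁ β} (curry₁-linear b) λ x y z w lx ly lz lw → ∧-falseˡ (γ (y ∷ z ∷ w ∷ [])) lx
  go (false ∷ true ∷ false ∷ false ∷ []) _ _ β γ b c = shapeˡ {l = curry₁ β} (curry₁-linear b) λ x y z w lx ly lz lw → ∧-falseˡ (γ (x ∷ z ∷ w ∷ [])) ly
  go (false ∷ false ∷ true ∷ false ∷ []) _ _ β γ b c = shapeˡ {l = curry₁ β} (curry₁-linear b) λ x y z w lx ly lz lw → ∧-falseˡ (γ (x ∷ y ∷ w ∷ [])) lz
  go (false ∷ false ∷ false ∷ true ∷ []) _ _ β γ b c = shapeˡ {l = curry₁ β} (curry₁-linear b) λ x y z w lx ly lz lw → ∧-falseˡ (γ (x ∷ y ∷ z ∷ [])) lw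
  go (false ∷ true ∷ true ∷ true ∷ []) _ _ β γ b c = shapeˡ {l = curry₁ γ} (curry₁-linear c) λ x y z w lx ly lz lw → ∧-falseʳ (β (y ∷ z ∷ w ∷ [])) lx
  go (true ∷ false ∷ true ∷ true ∷ []) _ _ β γ b c = shapeˡ {l = curry₁ γ} (curry₁-linear c) λ x y z w lx ly lz lw → ∧-falseʳ (β (x ∷ z ∷ w ∷ [])) ly
  go (true ∷ true ∷ false ∷ true ∷ []) _ _ β γ b c = shapeˡ {l = curry₁ γ} (curry₁-linear c) λ x y z w lx ly lz lw → ∧-falseʳ (β (x ∷ y ∷ w ∷ [])) lz
  go (true ∷ true ∷ true ∷ false ∷ []) _ _ β γ b c = shapeˡ {l = curry₁ γ} (curry₁-linear c) λ x y z w lx ly lz lw → ∧-falseʳ (β (x ∷ y ∷ z ∷ [])) lw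
  go (true ∷ true ∷ false ∷ false ∷ []) _ _ β γ b c = shapeᵖ 12∣34 (curry₂-bilinear b) (curry₂-bilinear c) λ _ _ _ _ → refl
  go (false ∷ false ∷ true ∷ true ∷ []) _ _ β γ b c = shapeᵖ 12∣34 (curry₂-bilinear c) (curry₂-bilinear b) λ x y z w → ∧-comm (curry₂ β z w) (curry₂ γ x y)
  go (true ∷ false ∷ true ∷ false ∷ []) _ _ β γ b c = shapeᵖ 13∣24 (curry₂-bilinear b) (curry₂-bilinear c) λ _ _ _ _ → refl
  go (false ∷ true ∷ false ∷ true ∷ []) _ _ β γ b c = shapeᵖ 13∣24 (curry₂-bilinear c) (curry₂-bilinear b) λ x y z w → ∧-comm (curry₂ β y w) (curry₂ γ x z)
  go (true ∷ false ∷ false ∷ true ∷ []) _ _ β γ b c = shapeᵖ 14∣23 (curry₂-bilinear b) (curry₂-bilinear c) λ _ _ _ _ → refl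
  go (false ∷ true ∷ true ∷ false ∷ []) _ _ β γ b c = shapeᵖ 14∣23 (curry₂-bilinear c) (curry₂-bilinear b) λ x y z w → ∧-comm (curry₂ β y z) (curry₂ γ x w)

-- Expansions in a family of bilinear forms

record Expansion {d} (v : G n → G n → Fin d → Bool) (r : Form₄ n) : Set where
  field
    A B C  : Fin d → Fin d → Bool
    expand : ∀ x y z w → r x y z w ≡
             ⟨ v x y ∣ A ∣ v z w ⟩ xor (⟨ v x z ∣ B ∣ v y w ⟩ xor ⟨ v x w ∣ C ∣ v y z ⟩)

module _ where

  open Expansion

  module _ {d} {v : G n → G n → Fin d → Bool} where

    expansion-zero : {r : Form₄ n} → (∀ x y z w → r x y z w ≡ false) → Expansion v r
    expansion-zero r≡0 = record
      { A = λ _ _ → false ; B = λ _ _ → false ; C = λ _ _ → false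
      ; expand = λ x y z w → trans (r≡0 x y z w) (sym (cong₂ _xor_ (⟨⟩-zero (v x y) (v z w)) (cong₂ _xor_ (⟨⟩-zero (v x z) (v y w)) (⟨⟩-zero (v x w) (v y z))))) }

    expansion-⊞ : {q r : Form₄ n} → Expansion v q → Expansion v r → Expansion v (q ⊞ r)
    expansion-⊞ {q} {r} X Y = record
      { A = λ i j → A X i j xor A Y i j
      ; B = λ i j → B X i j xor B Y i j
      ; C = λ i j → C X i j xor C Y i j
      ; expand = λ x y z w → trans (cong₂ _xor_ (expand X x y z w) (expand Y x y z w)) (trans
          (solve 6 (λ a b c a′ b′ c′ → (a :+ (b :+ c)) :+ (a′ :+ (b′ :+ c′)) := (a :+ a′) :+ ((b :+ b′) :+ (c :+ c′))) refl
            ⟨ v x y ∣ A X ∣ v z w ⟩ ⟨ v x z ∣ B X ∣ v y w ⟩ ⟨ v x w ∣ C X ∣ v y z ⟩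
            ⟨ v x y ∣ A Y ∣ v z w ⟩ ⟨ v x z ∣ B Y ∣ v y w ⟩ ⟨ v x w ∣ C Y ∣ v y z ⟩)
          (sym (cong₂ _xor_ (⟨⟩-+ (v x y) (A X) (A Y) (v z w)) (cong₂ _xor_ (⟨⟩-+ (v x z) (B X) (B Y) (v y w)) (⟨⟩-+ (v x w) (C X) (C Y) (v y z)))))) }

    expansion-cong : {q r : Form₄ n} → (∀ x y z w → q x y z w ≡ r x y z w) → Expansion v q → Expansion v r
    expansion-cong q≡r X = record
      { A = A X ; B = B X ; C = C X ; expand = λ x y z w → trans (sym (q≡r x y z w)) (expand X x y z w) }

    expansion-sum : ∀ {m} {rs : Fin m → Form₄ n} → (∀ t → Expansion v (rs t)) → Expansion v (λ x y z w → sum₂ (λ t → rs t x y z w))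
    expansion-sum {zero}  Xs = expansion-zero λ _ _ _ _ → refl
    expansion-sum {suc m} Xs = expansion-⊞ (Xs zero) (expansion-sum (Xs ∘ suc))

    expansion-arrange : ∀ p (i j : Fin d) → Expansion v (arrange p (λ x y → v x y i) (λ x y → v x y j))
    expansion-arrange p i j = expansion p
      where
      O Δ : Fin d → Fin d → Bool
      O _ _ = false
      Δ i′ j′ = unit i i′ ∧ unit j j′
      ⟨Δ⟩ : ∀ g h → ⟨ g ∣ Δ ∣ h ⟩ ≡ g i ∧ h j
      ⟨Δ⟩ g h = trans (⟨⟩-product (unit i) (unit j) g h) (cong₂ _∧_ (unit-∙ i g) (unit-∙ j h))
      expansion : ∀ p → Expansion v (arrange p (λ x y → v x y i) (λ x y → v x y j))
      expansion 12∣34 = record { A = Δ ; B = O ; C = O ; expand = λ x y z w → sym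
        (trans (cong₂ _xor_ (⟨Δ⟩ (v x y) (v z w)) (cong₂ _xor_ (⟨⟩-zero (v x z) (v y w)) (⟨⟩-zero (v x w) (v y z)))) (xor-identityʳ _)) }
      expansion 13∣24 = record { A = O ; B = Δ ; C = O ; expand = λ x y z w → sym
        (trans (cong₂ _xor_ (⟨⟩-zero (v x y) (v z w)) (cong₂ _xor_ (⟨Δ⟩ (v x z) (v y w)) (⟨⟩-zero (v x w) (v y z)))) (xor-identityʳ _)) }
      expansion 14∣23 = record { A = O ; B = O ; C = Δ ; expand = λ x y z w → sym
        (cong₂ _xor_ (⟨⟩-zero (v x y) (v z w)) (cong₂ _xor_ (⟨⟩-zero (v x z) (v y w)) (⟨Δ⟩ (v x w) (v y z)))) }

  -- The matrix is MᵀAM: substituting g = Mg′ and h = Mh′ turns gᵀAh into g′ᵀ(MᵀAM)h′.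
  ⟨⟩-congruence : ∀ {d e} (A : Fin d → Fin d → Bool) (M : Fin d → Fin e → Bool) →
    ∃[ A′ ] (∀ {g h : Fin d → Bool} {g′ h′ : Fin e → Bool} → (∀ i → g i ≡ M i ∙ g′) → (∀ i → h i ≡ M i ∙ h′) →
             ⟨ g ∣ A ∣ h ⟩ ≡ ⟨ g′ ∣ A′ ∣ h′ ⟩)
  ⟨⟩-congruence {d} {e} A M = A′ , λ {g} {h} {g′} {h′} g≡ h≡ → begin
    g ∙ (λ i → A i ∙ h)                          ≡⟨ ∙-cong g≡ (λ i → trans (∙-congˡ (A i) h≡)
                                                     (trans (∙-transpose (A i) M h′) (∙-comm h′ _))) ⟩
    (λ i → M i ∙ g′) ∙ (λ i → AM i ∙ h′)         ≡⟨ ∙-comm (λ i → M i ∙ g′) _ ⟩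
    (λ i → AM i ∙ h′) ∙ (λ i → M i ∙ g′)         ≡⟨ ∙-transpose (λ i → AM i ∙ h′) M g′ ⟩
    g′ ∙ (λ k → Mᵀ k ∙ (λ i → AM i ∙ h′))        ≡⟨ ∙-congˡ g′ (λ k → trans (∙-transpose (Mᵀ k) AM h′) (∙-comm h′ _)) ⟩
    g′ ∙ (λ k → A′ k ∙ h′)                       ∎
    where
    open ≡-Reasoning
    Mᵀ = λ k i → M i k
    AM : Fin d → Fin e → Bool
    AM i l = Mᵀ l ∙ A i
    A′ : Fin e → Fin e → Bool
    A′ k l = (λ i → AM i l) ∙ Mᵀ k

  expansion-change : ∀ {d e} {v : G n → G n → Fin d → Bool} {v′ : G n → G n → Fin e → Bool} {r : Form₄ n} (M : Fin d → Fin e → Bool) →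
                     (∀ x y i → v x y i ≡ M i ∙ v′ x y) → Expansion v r → Expansion v′ r
  expansion-change M v≡ X = record
    { A = proj₁ (⟨⟩-congruence (A X) M) ; B = proj₁ (⟨⟩-congruence (B X) M) ; C = proj₁ (⟨⟩-congruence (C X) M)
    ; expand = λ x y z w → trans (expand X x y z w) (cong₂ _xor_ (proj₂ (⟨⟩-congruence (A X) M) (v≡ x y) (v≡ z w))
        (cong₂ _xor_ (proj₂ (⟨⟩-congruence (B X) M) (v≡ x z) (v≡ y w)) (proj₂ (⟨⟩-congruence (C X) M) (v≡ x w) (v≡ y z)))) }

  expansion-∘ : ∀ {d} {v : G n → G n → Fin d → Bool} {r : Form₄ n} (P : G n → G n) →
                Expansion v r → Expansion (λ x y → v (P x) (P y)) (r ∘₄ P)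
  expansion-∘ P X = record { A = A X ; B = B X ; C = C X ; expand = λ x y z w → expand X (P x) (P y) (P z) (P w) }

-- Hypotheses and conclusion for curried forms

record Hypotheses (q : Form₄ n) : Set where
  field
    q-lin       : Quadrilinear q
    sym₁₂       : ∀ x y z w → q x y z w ≡ q y x z w
    sym₂₃       : ∀ x y z w → q x y z w ≡ q x z y w
    alternating : ∀ u z w → q u u z w ≡ false

hypotheses-∘ : {q : Form₄ n} {P : G n → G n} → Additive P → Hypotheses q → Hypotheses (q ∘₄ P)
hypotheses-∘ {P = P} P-add hyp = record
  { q-lin = quadrilinear-∘ P-add q-lin
  ; sym₁₂ = λ x y z w → sym₁₂ (P x) (P y) (P z) (P w)
  ; sym₂₃ = λ x y z w → sym₂₃ (P x) (P y) (P z) (P w)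
  ; alternating = λ u z w → alternating (P u) (P z) (P w) }
  where open Hypotheses hyp

-- Full symmetry of `q′` is recorded through the three adjacent transpositions, which generate S₄.
record Approximable (q : Form₄ n) (m : ℕ) : Set where
  field
    q′     : Form₄ n
    q′-lin : Quadrilinear q′
    q′₁₂   : ∀ x y z w → q′ x y z w ≡ q′ y x z w
    q′₂₃   : ∀ x y z w → q′ x y z w ≡ q′ x z y w
    q′₃₄   : ∀ x y z w → q′ x y z w ≡ q′ x y w z
    prank  : PrankAtMost₄ (q ⊞ q′) m

approximable-trans : (q q̃ : Form₄ n) → PrankAtMost₄ (q ⊞ q̃) m → Approximable q̃ m′ → Approximable q (m + m′)
approximable-trans q q̃ p ap = record
  { q′ = q′ ; q′-lin = q′-lin ; q′₁₂ = q′₁₂ ; q′₂₃ = q′₂₃ ; q′₃₄ = q′₃₄ ; prank = prank₄-trans q q̃ q′ p prank }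
  where open Approximable ap

approximable-≤ : {q : Form₄ n} → m ≤ m′ → Approximable q m → Approximable q m′
approximable-≤ m≤m′ ap = record
  { q′ = q′ ; q′-lin = q′-lin ; q′₁₂ = q′₁₂ ; q′₂₃ = q′₂₃ ; q′₃₄ = q′₃₄ ; prank = prank-≤ m≤m′ prank }
  where open Approximable ap

-- The form ρ of the overview.
defect : Form₄ n → Form₄ n
defect q x y z w = q x y z w xor q x y w z

-- An equation implies another if the two sum to zero.
infixl 1 _⇒_

_⇒_ : ∀ {a b c d} → a ≡ b → c xor d ≡ a xor b → c ≡ d
a≡b ⇒ eq = xor≡false⇒≡ (trans eq (≡⇒xor≡false a≡b))

linear-⟨⟩ˡ : ∀ {d e} {g : G n → Fin d → Bool} → (∀ i → Linear (λ x → g x i)) → ∀ (A : Fin d → Fin e → Bool) h →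
             Linear (λ x → ⟨ g x ∣ A ∣ h ⟩)
linear-⟨⟩ˡ {g = g} g-lin A h u v = trans (∙-cong (λ i → g-lin i u v) (λ _ → refl)) (⟨⟩-+ˡ (g u) (g v) A h)

linear-∙ʳ : ∀ {d} (c : Fin d → Bool) {h : G n → Fin d → Bool} → (∀ i → Linear (λ x → h x i)) → Linear (λ x → c ∙ h x)
linear-∙ʳ c {h} h-lin u v = trans (∙-congˡ c (λ i → h-lin i u v)) (∙-distribˡ c (h u) (h v))

bilinear-∙ : ∀ {d} (c : Fin d → Bool) {v : G n → G n → Fin d → Bool} → (∀ i → Bilinear (λ x y → v x y i)) →
             Bilinear (λ x y → c ∙ v x y)
bilinear-∙ c v-lin .linearˡ y = linear-∙ʳ c (λ i → linearˡ (v-lin i) y)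
bilinear-∙ c v-lin .linearʳ x = linear-∙ʳ c (λ i → linearʳ (v-lin i) x)

module _ {d} {v : G n → G n → Fin d → Bool} (v-lin : ∀ i → Bilinear (λ x y → v x y i)) (A : Fin d → Fin d → Bool) where

  private
    Av : ∀ i → Bilinear (λ x y → A i ∙ v x y)
    Av i = bilinear-∙ (A i) v-lin

    first : ∀ y h → Linear (λ x → ⟨ v x y ∣ A ∣ h ⟩)
    first y h = linear-⟨⟩ˡ (λ i → linearˡ (v-lin i) y) A h

    second : ∀ x h → Linear (λ y → ⟨ v x y ∣ A ∣ h ⟩)
    second x h = linear-⟨⟩ˡ (λ i → linearʳ (v-lin i) x) A h

    third : ∀ g w → Linear (λ z → ⟨ g ∣ A ∣ v z w ⟩)
    third g w = linear-∙ʳ g (λ i → linearˡ (Av i) w)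

    fourth : ∀ g z → Linear (λ w → ⟨ g ∣ A ∣ v z w ⟩)
    fourth g z = linear-∙ʳ g (λ i → linearʳ (Av i) z)

  quadrilinear-12∣34 : Quadrilinear (λ x y z w → ⟨ v x y ∣ A ∣ v z w ⟩)
  quadrilinear-12∣34 = record
    { linear₁ = λ y z w → first y (v z w) ; linear₂ = λ x z w → second x (v z w)
    ; linear₃ = λ x y w → third (v x y) w ; linear₄ = λ x y z → fourth (v x y) z }

  quadrilinear-13∣24 : Quadrilinear (λ x y z w → ⟨ v x z ∣ A ∣ v y w ⟩)
  quadrilinear-13∣24 = record
    { linear₁ = λ y z w → first z (v y w) ; linear₂ = λ x z w → third (v x z) w
    ; linear₃ = λ x y w → second x (v y w) ; linear₄ = λ x y z → fourth (v x z) y }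

  quadrilinear-23∣14 : Quadrilinear (λ x y z w → ⟨ v y z ∣ A ∣ v x w ⟩)
  quadrilinear-23∣14 = record
    { linear₁ = λ y z w → third (v y z) w ; linear₂ = λ x z w → first z (v x w)
    ; linear₃ = λ x y w → second y (v x w) ; linear₄ = λ x y z → fourth (v y z) x }

  prank-⟨12∣34⟩ : PrankAtMost₄ (λ x y z w → ⟨ v x y ∣ A ∣ v z w ⟩) d
  prank-⟨12∣34⟩ = prank₄-sum (λ i x y z w → v x y i ∧ A i ∙ v z w) (λ i → prank-12∣34 (v-lin i) (Av i))

  prank-⟨13∣24⟩ : PrankAtMost₄ (λ x y z w → ⟨ v x z ∣ A ∣ v y w ⟩) d
  prank-⟨13∣24⟩ = prank₄-sum (λ i x y z w → v x z i ∧ A i ∙ v y w) (λ i → prank-13∣24 (v-lin i) (Av i))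

  prank-⟨23∣14⟩ : PrankAtMost₄ (λ x y z w → ⟨ v y z ∣ A ∣ v x w ⟩) d
  prank-⟨23∣14⟩ = prank₄-sum (λ i x y z w → v y z i ∧ A i ∙ v x w) (λ i → prank-23∣14 (v-lin i) (Av i))

-- Symmetrisation over an independent family

functionRank-false : FunctionRank 0 (λ (_ _ : G n) → false)
functionRank-false = (λ _ ()) , (λ _ ()) , λ _ _ → refl

<?-flip : ∀ {d} (i j : Fin d) → i ≢ j → does (j <? i) ≡ not (does (i <? j))
<?-flip i j i≢j with <-cmp i j
... | tri< i<j _ j≮i = trans (dec-false (j <? i) j≮i) (cong not (sym (dec-true (i <? j) i<j)))
... | tri≈ _ i≡j _   = contradiction i≡j i≢j
... | tri> i≮j _ j<i = trans (dec-true (j <? i) j<i) (cong not (sym (dec-false (i <? j) i≮j)))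

-- One entry of B = W + Wᵀ. Here s and t say whether i and j are marked, l and l′ whether i < j and
-- j < i. If both are marked the entry is zero; if one is, the entry goes to the row of the unmarked
-- index; if neither is, the order of i and j selects the row, which is possible because a nonzero
-- entry lies off the diagonal.
halve : ∀ s t l l′ b b′ → t ∧ (s ∧ b) ≡ false → b ≡ b′ → (b ≡ true → l′ ≡ not l) →
        b ≡ (not s ∧ ((t ∨ l) ∧ b)) xor (not t ∧ ((s ∨ l′) ∧ b′))
halve true  true  l l′ b b′ b≡0 b≡b′ _ = b≡0
halve true  false l l′ b b′ _   b≡b′ _ = b≡b′
halve false true  l l′ b b′ _   b≡b′ _ = sym (xor-identityʳ b)
halve false false l l′ false .false _ refl _ = sym (cong₂ _xor_ (∧-zeroʳ l) (∧-zeroʳ l′))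
halve false false l l′ true  .true  _ refl flip with l | l′ | flip refl
... | true  | .false | refl = refl
... | false | .true  | refl = refl

-- `s` marks the forms not known to be symmetric. By `no-symmetric` the unmarked ones span all
-- symmetric forms in V, so they are a basis of V₀ that the marked ones extend to a basis of V.
module Independent {n d K}
  (6d≤K : 6 * d ≤ K)
  (v : G n → G n → Fin d → Bool) (v-lin : ∀ i → Bilinear (λ x y → v x y i))
  (s : Subset d) (v-sym : ∀ i → lookup s i ≡ false → ∀ x y → v x y i ≡ v y x i)
  (independent : ∀ c → Low K (λ x y → c ∙ v x y) → ∀ i → c i ≡ false)
  (no-symmetric : ∀ c → (∀ i → lookup s i ≡ false → c i ≡ false) → (∀ x y → c ∙ v x y ≡ c ∙ v y x) → ∀ i → c i ≡ false)
  (q : Form₄ n) (hyp : Hypotheses q) (X : Expansion v (defect q)) where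

  open Hypotheses hyp
  open Expansion X

  -- No linearity is asked of `F`: in `B-diagonal` it is built from v(w,w), which is quadratic in w.
  vanish : ∀ {m} (c : Fin d → Bool) {F : G n → G n → Bool} → m ≤ K → FunctionRank m F → (∀ x y → c ∙ v x y ≡ F x y) → ∀ i → c i ≡ false
  vanish {m} c m≤K rank c≡F = independent c (low-≤ m≤K (low-cong (λ x y → sym (c≡F x y)) (functionRank⇒low m rank)))

  -- For fixed y and w the left side is a combination of the forms v(x,z), so its coefficients, rows
  -- of `M` paired with v(y,w), are zero. As y and w vary, this is a vanishing combination for each
  -- row, and independence applies again.
  vanish-matrix : ∀ {m} (M : Fin d → Fin d → Bool) {F : Form₄ n} → m ≤ K → (∀ y w → FunctionRank m (λ x z → F x y z w)) →
                  (∀ x y z w → ⟨ v x z ∣ M ∣ v y w ⟩ ≡ F x y z w) → ∀ i j → M i j ≡ false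
  vanish-matrix M m≤K rank M≡F i = vanish (M i) z≤n functionRank-false λ y w →
    vanish (λ i → M i ∙ v y w) m≤K (rank y w) (λ x z → trans (∙-comm _ (v x z)) (M≡F x y z w)) i

  4d≤K : 4 * d ≤ K
  4d≤K = ℕ.≤-trans (ℕ.*-monoˡ-≤ d (ℕ.m≤m+n 4 2)) 6d≤K

  -- ρ is invariant under z ↔ w, which carries the C-term to the pairing xz|yw. The four remaining
  -- terms separate x from z and have rank at most d each.
  B≡C : ∀ i j → B i j ≡ C i j
  B≡C i j = xor≡false⇒≡ (vanish-matrix (λ i j → B i j xor C i j)
    {λ x y z w → ⟨ v x y ∣ A ∣ v z w ⟩ xor (⟨ v x y ∣ A ∣ v w z ⟩ xor (⟨ v x w ∣ B ∣ v y z ⟩ xor (⟨ v x w ∣ C ∣ v y z ⟩ xor false)))}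
    4d≤K
    (λ y w → functionRank-xor (functionRank-⟨⟩ (λ x → v x y) A (λ z → v z w))
            (functionRank-xor (functionRank-⟨⟩ (λ x → v x y) A (λ z → v w z))
            (functionRank-xor (functionRank-⟨⟩ (λ x → v x w) B (λ z → v y z))
            (functionRank-xor (functionRank-⟨⟩ (λ x → v x w) C (λ z → v y z)) functionRank-false))))
    (λ x y z w → trans (⟨⟩-+ (v x z) B C (v y w))
      (trans (sym (expand x y z w)) (trans (xor-comm (q x y z w) (q x y w z)) (expand x y w z))
      ⇒ solve 6 (λ a b c a′ b′ c′ → (b :+ c′) :+ (a :+ (a′ :+ (b′ :+ (c :+ con false)))) := (a :+ (b :+ c)) :+ (a′ :+ (b′ :+ c′))) refl
          ⟨ v x y ∣ A ∣ v z w ⟩ ⟨ v x z ∣ B ∣ v y w ⟩ ⟨ v x w ∣ C ∣ v y z ⟩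
          ⟨ v x y ∣ A ∣ v w z ⟩ ⟨ v x w ∣ B ∣ v y z ⟩ ⟨ v x z ∣ C ∣ v y w ⟩))
    i j)

  defect-sym₁₂ : ∀ x y z w → defect q x y z w ≡ defect q y x z w
  defect-sym₁₂ x y z w = cong₂ _xor_ (sym₁₂ x y z w) (sym₁₂ x y w z)

  -- The same comparison for x ↔ y. This swap exchanges the two factors, and so brings the C-term to
  -- the pairing xz|yw with its matrix transposed.
  B≡Cᵀ : ∀ i j → B i j ≡ C j i
  B≡Cᵀ i j = xor≡false⇒≡ (vanish-matrix (λ i j → B i j xor C j i)
    {λ x y z w → ⟨ v x y ∣ A ∣ v z w ⟩ xor (⟨ v y x ∣ A ∣ v z w ⟩ xor (⟨ v x w ∣ C ∣ v y z ⟩ xor (⟨ v x w ∣ Bᵀ ∣ v y z ⟩ xor false)))}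
    4d≤K
    (λ y w → functionRank-xor (functionRank-⟨⟩ (λ x → v x y) A (λ z → v z w))
            (functionRank-xor (functionRank-⟨⟩ (λ x → v y x) A (λ z → v z w))
            (functionRank-xor (functionRank-⟨⟩ (λ x → v x w) C (λ z → v y z))
            (functionRank-xor (functionRank-⟨⟩ (λ x → v x w) Bᵀ (λ z → v y z)) functionRank-false))))
    (λ x y z w → trans (⟨⟩-+ (v x z) B (λ i j → C j i) (v y w))
      (trans (sym (expand x y z w)) (trans (defect-sym₁₂ x y z w) (trans (expand y x z w)
         (cong (⟨ v y x ∣ A ∣ v z w ⟩ xor_) (cong₂ _xor_ (∙-transpose (v y z) B (v x w)) (∙-transpose (v y w) C (v x z))))))
      ⇒ solve 6 (λ a b c a′ b′ c′ → (b :+ c′) :+ (a :+ (a′ :+ (c :+ (b′ :+ con false)))) := (a :+ (b :+ c)) :+ (a′ :+ (b′ :+ c′))) refl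
          ⟨ v x y ∣ A ∣ v z w ⟩ ⟨ v x z ∣ B ∣ v y w ⟩ ⟨ v x w ∣ C ∣ v y z ⟩
          ⟨ v y x ∣ A ∣ v z w ⟩ ⟨ v x w ∣ Bᵀ ∣ v y z ⟩ ⟨ v x z ∣ (λ i j → C j i) ∣ v y w ⟩))
    i j)
    where
    Bᵀ : Fin d → Fin d → Bool
    Bᵀ i j = B j i

  B-sym : ∀ i j → B i j ≡ B j i
  B-sym i j = trans (B≡Cᵀ i j) (sym (B≡C j i))

  ⟨B⟩-sym : ∀ g h → ⟨ g ∣ B ∣ h ⟩ ≡ ⟨ h ∣ B ∣ g ⟩
  ⟨B⟩-sym g h = trans (∙-transpose g B h) (∙-congˡ h (λ j → ∙-cong (λ i → B-sym i j) (λ _ → refl)))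

  expand-B : ∀ x y z w → defect q x y z w ≡ ⟨ v x y ∣ A ∣ v z w ⟩ xor (⟨ v x z ∣ B ∣ v y w ⟩ xor ⟨ v x w ∣ B ∣ v y z ⟩)
  expand-B x y z w = trans (expand x y z w) (cong (λ c → ⟨ v x y ∣ A ∣ v z w ⟩ xor (⟨ v x z ∣ B ∣ v y w ⟩ xor c))
    (∙-congˡ (v x w) (λ i → ∙-cong (λ j → sym (B≡C i j)) (λ _ → refl))))

  -- By symmetry in the first three variables a value of `q` depends only on which variable is last;
  -- the choices y, z and w occur twice each.
  cocycle : ∀ x y z w → defect q x y z w xor (defect q x z y w xor defect q x w y z) ≡ false
  cocycle x y z w = trans
    (cong₂ (λ a b → defect q x y z w xor (a xor b)) (cong (_xor q x z w y) (sym₂₃ x z y w)) (cong₂ _xor_ (sym₂₃ x w y z) (sym₂₃ x w z y)))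
    (solve 3 (λ a b c → (a :+ b) :+ ((a :+ c) :+ (b :+ c)) := con false) refl (q x y z w) (q x y w z) (q x z w y))

  -- In the expanded cocycle identity three terms pair x with y; the other six separate them when z
  -- and w are fixed, and this is where 6d ≤ K is used in full. The A-term is matched with B-terms
  -- at both v(z,w) and v(w,z), so the second factor cannot be stripped off.
  A≡B : ∀ i z w → A i ∙ v z w ≡ B i ∙ v z w xor B i ∙ v w z
  A≡B i z w = xor≡false⇒≡ (vanish (λ i → A i ∙ v z w xor (B i ∙ v z w xor B i ∙ v w z))
    {λ x y → ⟨ v x z ∣ B ∣ v y w ⟩ xor (⟨ v x w ∣ B ∣ v y z ⟩ xor (⟨ v x z ∣ A ∣ v y w ⟩ xor (⟨ v x w ∣ B ∣ v z y ⟩ xor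
                 (⟨ v x w ∣ A ∣ v y z ⟩ xor (⟨ v x z ∣ B ∣ v w y ⟩ xor false)))))}
    6d≤K
    (functionRank-xor (functionRank-⟨⟩ (λ x → v x z) B (λ y → v y w))
    (functionRank-xor (functionRank-⟨⟩ (λ x → v x w) B (λ y → v y z))
    (functionRank-xor (functionRank-⟨⟩ (λ x → v x z) A (λ y → v y w))
    (functionRank-xor (functionRank-⟨⟩ (λ x → v x w) B (λ y → v z y))
    (functionRank-xor (functionRank-⟨⟩ (λ x → v x w) A (λ y → v y z))
    (functionRank-xor (functionRank-⟨⟩ (λ x → v x z) B (λ y → v w y)) functionRank-false))))))
    (λ x y → begin
      (λ i → A i ∙ v z w xor (B i ∙ v z w xor B i ∙ v w z)) ∙ v x y
        ≡⟨ ∙-comm _ (v x y) ⟩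
      v x y ∙ (λ i → A i ∙ v z w xor (B i ∙ v z w xor B i ∙ v w z))
        ≡⟨ trans (∙-distribˡ (v x y) _ _) (cong (⟨ v x y ∣ A ∣ v z w ⟩ xor_) (∙-distribˡ (v x y) _ _)) ⟩
      ⟨ v x y ∣ A ∣ v z w ⟩ xor (⟨ v x y ∣ B ∣ v z w ⟩ xor ⟨ v x y ∣ B ∣ v w z ⟩)
        ≡⟨ (trans (sym (cong₂ _xor_ (expand-B x y z w) (cong₂ _xor_ (expand-B x z y w) (expand-B x w y z)))) (cocycle x y z w)
           ⇒ solve 9 (λ a b c a′ b′ c′ a″ b″ c″ →
               (a :+ (b′ :+ b″)) :+ (b :+ (c :+ (a′ :+ (c′ :+ (a″ :+ (c″ :+ con false)))))) :=
               ((a :+ (b :+ c)) :+ ((a′ :+ (b′ :+ c′)) :+ (a″ :+ (b″ :+ c″)))) :+ con false) refl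
               ⟨ v x y ∣ A ∣ v z w ⟩ ⟨ v x z ∣ B ∣ v y w ⟩ ⟨ v x w ∣ B ∣ v y z ⟩
               ⟨ v x z ∣ A ∣ v y w ⟩ ⟨ v x y ∣ B ∣ v z w ⟩ ⟨ v x w ∣ B ∣ v z y ⟩
               ⟨ v x w ∣ A ∣ v y z ⟩ ⟨ v x y ∣ B ∣ v w z ⟩ ⟨ v x z ∣ B ∣ v w y ⟩) ⟩
      _ ∎)
    i)
    where open ≡-Reasoning

  ⟨A⟩≡⟨B⟩ : ∀ g z w → ⟨ g ∣ A ∣ v z w ⟩ ≡ ⟨ g ∣ B ∣ v z w ⟩ xor ⟨ g ∣ B ∣ v w z ⟩
  ⟨A⟩≡⟨B⟩ g z w = trans (∙-congˡ g (λ i → A≡B i z w)) (∙-distribˡ g _ _)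

  ⟨A⟩-sym₁₂ : ∀ x y z w → ⟨ v x y ∣ A ∣ v z w ⟩ ≡ ⟨ v y x ∣ A ∣ v z w ⟩
  ⟨A⟩-sym₁₂ x y z w =
    trans (sym (expand-B x y z w)) (trans (defect-sym₁₂ x y z w) (trans (expand-B y x z w)
      (cong (⟨ v y x ∣ A ∣ v z w ⟩ xor_) (cong₂ _xor_ (⟨B⟩-sym (v y z) (v x w)) (⟨B⟩-sym (v y w) (v x z))))))
    ⇒ solve 4 (λ a a′ b c → a :+ a′ := (a :+ (b :+ c)) :+ (a′ :+ (c :+ b))) refl
        ⟨ v x y ∣ A ∣ v z w ⟩ ⟨ v y x ∣ A ∣ v z w ⟩ ⟨ v x z ∣ B ∣ v y w ⟩ ⟨ v x w ∣ B ∣ v y z ⟩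

  -- Antisymmetrisation of the family. It kills the unmarked coordinates, and no nonzero functional
  -- of the marked ones kills all its values.
  δ : G n → G n → Fin d → Bool
  δ x y i = v x y i xor v y x i

  δ-support : ∀ x y i → lookup s i ∧ δ x y i ≡ δ x y i
  δ-support x y i with lookup s i in eq
  ... | true  = refl
  ... | false = sym (≡⇒xor≡false (v-sym i eq x y))

  -- The marked part of `b` gives a combination of marked forms whose antisymmetrisation vanishes;
  -- it is symmetric, hence zero.
  δ-independent : ∀ b → (∀ x y → b ∙ δ x y ≡ false) → ∀ i → lookup s i ∧ b i ≡ false
  δ-independent b b∙δ = no-symmetric (λ i → lookup s i ∧ b i) (λ i si → cong (_∧ b i) si) (λ x y → xor≡false⇒≡ (begin
      sb ∙ v x y xor sb ∙ v y x                   ≡⟨ sym (∙-distribˡ sb (v x y) (v y x)) ⟩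
      sb ∙ δ x y                                  ≡⟨ sum-cong-≋ (λ i → trans
                                                      (solve 3 (λ s b t → (s :* b) :* t := b :* (s :* t)) refl (lookup s i) (b i) (δ x y i))
                                                      (cong (b i ∧_) (δ-support x y i))) ⟩
      b ∙ δ x y                                   ≡⟨ b∙δ x y ⟩
      false                                       ∎))
    where
    open ≡-Reasoning
    sb : Fin d → Bool
    sb i = lookup s i ∧ b i

  -- Antisymmetrising the second factor of B produces A, and A is unchanged when the variables of
  -- its first factor are swapped.
  ⟨δ∣B∣δ⟩ : ∀ x y z w → ⟨ δ x y ∣ B ∣ δ z w ⟩ ≡ false
  ⟨δ∣B∣δ⟩ x y z w = begin
    ⟨ δ x y ∣ B ∣ δ z w ⟩                            ≡⟨ ⟨⟩-+ˡ (v x y) (v y x) B (δ z w) ⟩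
    ⟨ v x y ∣ B ∣ δ z w ⟩ xor ⟨ v y x ∣ B ∣ δ z w ⟩  ≡⟨ cong₂ _xor_ (to-A (v x y)) (to-A (v y x)) ⟩
    ⟨ v x y ∣ A ∣ v z w ⟩ xor ⟨ v y x ∣ A ∣ v z w ⟩  ≡⟨ ≡⇒xor≡false (⟨A⟩-sym₁₂ x y z w) ⟩
    false                                            ∎
    where
    open ≡-Reasoning
    to-A : ∀ g → ⟨ g ∣ B ∣ δ z w ⟩ ≡ ⟨ g ∣ A ∣ v z w ⟩
    to-A g = trans (⟨⟩-+ʳ g B (v z w) (v w z)) (sym (⟨A⟩≡⟨B⟩ g z w))

  -- `δ-independent` is applied once in each factor of ⟨δ∣B∣δ⟩ = 0, leaving only the block of B with
  -- both indices marked.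
  B-nonsymmetric : ∀ i j → lookup s j ∧ (lookup s i ∧ B i j) ≡ false
  B-nonsymmetric i = δ-independent (λ j → lookup s i ∧ B i j) λ z w →
    trans (∙-scaleˡ (lookup s i) (B i) (δ z w))
          (δ-independent (λ i → B i ∙ δ z w) (λ x y → trans (∙-comm _ (δ x y)) (⟨δ∣B∣δ⟩ x y z w)) i)

  -- With this both terms of ρ(w,u,w,u) vanish: the first repeats w, the second u, among the first
  -- three arguments.
  q-aba : ∀ a b c → q a b a c ≡ false
  q-aba a b c = trans (sym₂₃ a b a c) (alternating a b c)

  -- ρ(w,u,w,u) = 0 reads Σ Bᵢᵢ vᵢ(w,u) = Σ Bᵢⱼ vᵢ(w,w) vⱼ(u,u), and the right-hand side has function rank at most d.
  B-diagonal : ∀ i → B i i ≡ false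
  B-diagonal = vanish (λ i → B i i) (ℕ.≤-trans (ℕ.m≤n*m d 6) 6d≤K)
    (functionRank-⟨⟩ (λ w → v w w) B (λ u → v u u))
    λ w u → trans (sym (⟨⟩-diagonal B B-sym (v w u)))
      (trans (sym (cong₂ _xor_ (q-aba w u u) (trans (sym₁₂ w u u w) (q-aba u w w))))
        (trans (expand-B w u w u) (cong (_xor (⟨ v w w ∣ B ∣ v u u ⟩ xor ⟨ v w u ∣ B ∣ v u w ⟩)) (⟨A⟩≡⟨B⟩ (v w u) w u)))
      ⇒ solve 3 (λ a b c → a :+ b := con false :+ ((a :+ c) :+ (b :+ c))) refl
          ⟨ v w u ∣ B ∣ v w u ⟩ ⟨ v w w ∣ B ∣ v u u ⟩ ⟨ v w u ∣ B ∣ v u w ⟩)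

  -- A half of B, with rows supported on the symmetric forms.
  W : Fin d → Fin d → Bool
  W i j = not (lookup s i) ∧ ((lookup s j ∨ does (i <? j)) ∧ B i j)

  W+Wᵀ : ∀ i j → B i j ≡ W i j xor W j i
  W+Wᵀ i j = halve (lookup s i) (lookup s j) (does (i <? j)) (does (j <? i)) (B i j) (B j i)
    (B-nonsymmetric i j) (B-sym i j)
    (λ Bij → <?-flip i j (λ i≡j → contradiction (trans (sym Bij) (trans (cong (B i) (sym i≡j)) (B-diagonal i))) λ ()))

  ⟨B⟩≡⟨W⟩ : ∀ g h → ⟨ g ∣ B ∣ h ⟩ ≡ ⟨ g ∣ W ∣ h ⟩ xor ⟨ h ∣ W ∣ g ⟩
  ⟨B⟩≡⟨W⟩ g h = trans (∙-congˡ g (λ i → ∙-cong (W+Wᵀ i) (λ _ → refl)))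
    (trans (⟨⟩-+ g W (λ i j → W j i) h) (cong (⟨ g ∣ W ∣ h ⟩ xor_) (sym (∙-transpose h W g))))

  ⟨W⟩-sym : ∀ x y h → ⟨ v x y ∣ W ∣ h ⟩ ≡ ⟨ v y x ∣ W ∣ h ⟩
  ⟨W⟩-sym x y h = sum-cong-≋ λ i → row i
    where
    row : ∀ i → v x y i ∧ W i ∙ h ≡ v y x i ∧ W i ∙ h
    row i with lookup s i in eq
    ... | false = cong (_∧ (λ j → (lookup s j ∨ does (i <? j)) ∧ B i j) ∙ h) (v-sym i eq x y)
    ... | true  = trans (∧-falseʳ (v x y i) (∙-zeroˡ h (λ _ → refl))) (sym (∧-falseʳ (v y x i) (∙-zeroˡ h (λ _ → refl))))

  -- The sum runs over the three possible partners of w. Since the first factor of W is symmetric in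
  -- its pair, the result is symmetric in x, y and z.
  η : Form₄ n
  η x y z w = ⟨ v x y ∣ W ∣ v z w ⟩ xor (⟨ v x z ∣ W ∣ v y w ⟩ xor ⟨ v y z ∣ W ∣ v x w ⟩)

  -- Writing B as W + Wᵀ turns ρ into six terms after the transposed parts inside A cancel, by
  -- symmetry of the first factor of W. Equal defects make `q ⊞ η` invariant under z ↔ w.
  defect-η : ∀ x y z w → defect q x y z w ≡ defect η x y z w
  defect-η x y z w = begin
    defect q x y z w
      ≡⟨ expand-B x y z w ⟩
    ⟨ v x y ∣ A ∣ v z w ⟩ xor (⟨ v x z ∣ B ∣ v y w ⟩ xor ⟨ v x w ∣ B ∣ v y z ⟩)
      ≡⟨ cong₂ _xor_ ⟨A⟩≡⟨W⟩ (cong₂ _xor_ (⟨B⟩≡⟨W⟩ (v x z) (v y w)) (⟨B⟩≡⟨W⟩ (v x w) (v y z))) ⟩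
    (⟨ v x y ∣ W ∣ v z w ⟩ xor ⟨ v x y ∣ W ∣ v w z ⟩) xor
      ((⟨ v x z ∣ W ∣ v y w ⟩ xor ⟨ v y w ∣ W ∣ v x z ⟩) xor (⟨ v x w ∣ W ∣ v y z ⟩ xor ⟨ v y z ∣ W ∣ v x w ⟩))
      ≡⟨ solve 6 (λ a a′ b b′ c c′ → (a :+ a′) :+ ((b :+ b′) :+ (c :+ c′)) := (a :+ (b :+ c′)) :+ (a′ :+ (c :+ b′))) refl
           ⟨ v x y ∣ W ∣ v z w ⟩ ⟨ v x y ∣ W ∣ v w z ⟩ ⟨ v x z ∣ W ∣ v y w ⟩ ⟨ v y w ∣ W ∣ v x z ⟩ ⟨ v x w ∣ W ∣ v y z ⟩ ⟨ v y z ∣ W ∣ v x w ⟩ ⟩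
    defect η x y z w ∎
    where
    open ≡-Reasoning
    ⟨A⟩≡⟨W⟩ : ⟨ v x y ∣ A ∣ v z w ⟩ ≡ ⟨ v x y ∣ W ∣ v z w ⟩ xor ⟨ v x y ∣ W ∣ v w z ⟩
    ⟨A⟩≡⟨W⟩ = begin
      ⟨ v x y ∣ A ∣ v z w ⟩
        ≡⟨ ⟨A⟩≡⟨B⟩ (v x y) z w ⟩
      ⟨ v x y ∣ B ∣ v z w ⟩ xor ⟨ v x y ∣ B ∣ v w z ⟩
        ≡⟨ cong₂ _xor_ (⟨B⟩≡⟨W⟩ (v x y) (v z w)) (trans (⟨B⟩≡⟨W⟩ (v x y) (v w z)) (cong (⟨ v x y ∣ W ∣ v w z ⟩ xor_) (⟨W⟩-sym w z (v x y)))) ⟩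
      (⟨ v x y ∣ W ∣ v z w ⟩ xor ⟨ v z w ∣ W ∣ v x y ⟩) xor (⟨ v x y ∣ W ∣ v w z ⟩ xor ⟨ v z w ∣ W ∣ v x y ⟩)
        ≡⟨ solve 3 (λ a b c → (a :+ b) :+ (c :+ b) := a :+ c) refl ⟨ v x y ∣ W ∣ v z w ⟩ ⟨ v z w ∣ W ∣ v x y ⟩ ⟨ v x y ∣ W ∣ v w z ⟩ ⟩
      ⟨ v x y ∣ W ∣ v z w ⟩ xor ⟨ v x y ∣ W ∣ v w z ⟩ ∎

  η-sym₁₂ : ∀ x y z w → η x y z w ≡ η y x z w
  η-sym₁₂ x y z w = cong₂ _xor_ (⟨W⟩-sym x y (v z w)) (xor-comm ⟨ v x z ∣ W ∣ v y w ⟩ ⟨ v y z ∣ W ∣ v x w ⟩)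

  η-sym₂₃ : ∀ x y z w → η x y z w ≡ η x z y w
  η-sym₂₃ x y z w = trans
    (solve 3 (λ a b c → a :+ (b :+ c) := b :+ (a :+ c)) refl ⟨ v x y ∣ W ∣ v z w ⟩ ⟨ v x z ∣ W ∣ v y w ⟩ ⟨ v y z ∣ W ∣ v x w ⟩)
    (cong (λ c → ⟨ v x z ∣ W ∣ v y w ⟩ xor (⟨ v x y ∣ W ∣ v z w ⟩ xor c)) (⟨W⟩-sym y z (v x w)))

  approximation : Approximable q (3 * d)
  approximation = record
    { q′     = q ⊞ η
    ; q′-lin = quadrilinear-⊞ q-lin (quadrilinear-⊞ (quadrilinear-12∣34 v-lin W) (quadrilinear-⊞ (quadrilinear-13∣24 v-lin W) (quadrilinear-23∣14 v-lin W)))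
    ; q′₁₂   = λ x y z w → cong₂ _xor_ (sym₁₂ x y z w) (η-sym₁₂ x y z w)
    ; q′₂₃   = λ x y z w → cong₂ _xor_ (sym₂₃ x y z w) (η-sym₂₃ x y z w)
    ; q′₃₄   = λ x y z w → defect-η x y z w
                 ⇒ solve 4 (λ a b c d → (a :+ c) :+ (b :+ d) := (a :+ b) :+ (c :+ d)) refl
                     (q x y z w) (q x y w z) (η x y z w) (η x y w z)
    ; prank  = prank₄-cong (λ x y z w → solve 2 (λ a b → b := a :+ (a :+ b)) refl (q x y z w) (η x y z w))
                 (prank-≤ (ℕ.≤-reflexive (cong (λ m → d + (d + m)) (sym (ℕ.+-identityʳ d))))
                 (prank₄-⊞ (prank-⟨12∣34⟩ v-lin W) (prank₄-⊞ (prank-⟨13∣24⟩ v-lin W) (prank-⟨23∣14⟩ v-lin W))))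
    }

-- Reduction to an independent family

BilinearFamily : ∀ {d} → (G n → G n → Fin d → Bool) → Set
BilinearFamily v = ∀ i → Bilinear (λ x y → v x y i)

relation⇒member : ∀ {d} (c g : Fin (suc d) → Bool) (i : Fin (suc d)) → c i ≡ true → c ∙ g ≡ false →
                  g i ≡ (c ∘ punchIn i) ∙ (g ∘ punchIn i)
relation⇒member c g i ci c∙g = xor≡false⇒≡ (trans (sym (trans (∙-remove i c g)
  (cong (λ b → b ∧ g i xor (c ∘ punchIn i) ∙ (g ∘ punchIn i)) ci))) c∙g)

-- Row j of the matrix that writes the old family through the one with member i dropped; row i is
-- read off the relation c.
without : ∀ {d} → (Fin (suc d) → Bool) → Fin (suc d) → Fin (suc d) → Fin d → Bool
without c i j with i ≟ j
... | yes _  = c ∘ punchIn i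
... | no i≢j = unit (punchOut i≢j)

without-∙ : ∀ {d} (c g : Fin (suc d) → Bool) (i : Fin (suc d)) → c i ≡ true → c ∙ g ≡ false →
            ∀ j → g j ≡ without c i j ∙ (g ∘ punchIn i)
without-∙ c g i ci c∙g j with i ≟ j
... | yes refl = relation⇒member c g i ci c∙g
... | no i≢j   = sym (trans (unit-∙ (punchOut i≢j) (g ∘ punchIn i)) (cong g (punchIn-punchOut i≢j)))

replaced : ∀ {d} {i j : Fin d} → Bool → Bool → Dec (i ≡ j) → Bool
replaced a b (yes _) = a
replaced a b (no _)  = b

replaceRow : ∀ {d} {i j : Fin d} → (Fin d → Bool) → Dec (i ≡ j) → Fin d → Bool
replaceRow     c (yes _) = c
replaceRow {j = j} c (no _)  = unit j

replace : ∀ {d} → (Fin d → Bool) → Fin d → (Fin d → Bool) → Fin d → Bool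
replace c i g j = replaced (c ∙ g) (g j) (i ≟ j)

replace-same : ∀ {d} (c : Fin d → Bool) i g → replace c i g i ≡ c ∙ g
replace-same c i g with i ≟ i
... | yes _  = refl
... | no i≢i = contradiction refl i≢i

replace-other : ∀ {d} (c : Fin d → Bool) {i j} g → i ≢ j → replace c i g j ≡ g j
replace-other c {i} {j} g i≢j with i ≟ j
... | yes i≡j = contradiction i≡j i≢j
... | no _    = refl

-- Over 𝔽₂ exchanging the i-th coordinate for c ∙ g with cᵢ = 1 is an involution, so the same c
-- recovers the old coordinate.
replace-∙ : ∀ {d} (c g : Fin d → Bool) i → c i ≡ true → ∀ j → g j ≡ replaceRow c (i ≟ j) ∙ replace c i g
replace-∙ {suc d} c g i ci j with i ≟ j
... | no i≢j   = sym (trans (unit-∙ j (replace c i g)) (replace-other c g i≢j))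
... | yes refl = sym (begin
  c ∙ replace c i g
    ≡⟨ ∙-remove i c (replace c i g) ⟩
  c i ∧ replace c i g i xor (c ∘ punchIn i) ∙ (replace c i g ∘ punchIn i)
    ≡⟨ cong₂ _xor_ (cong₂ _∧_ ci (replace-same c i g)) (∙-congˡ (c ∘ punchIn i) (λ k → replace-other c g (punchInᵢ≢i i k ∘ sym))) ⟩
  c ∙ g xor rest
    ≡⟨ cong (_xor rest) (trans (∙-remove i c g) (cong (λ b → b ∧ g i xor rest) ci)) ⟩
  (g i xor rest) xor rest
    ≡⟨ trans (xor-assoc (g i) rest rest) (trans (cong (g i xor_) (xor-same rest)) (xor-identityʳ (g i))) ⟩
  g i ∎)
  where
  open ≡-Reasoning
  rest : Bool
  rest = (c ∘ punchIn i) ∙ (g ∘ punchIn i)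

outside-minus : ∀ {d} (s : Subset d) i j → lookup (s - i) j ≡ false → i ≡ j ⊎ lookup s j ≡ false
outside-minus s i j s-ij with i ≟ j
... | yes i≡j = inj₁ i≡j
... | no i≢j  = inj₂ (¬-not λ sj →
  contradiction (trans (sym s-ij) ([]=⇒lookup (x∈p∧x≢y⇒x∈p-y (lookup⇒[]= j s sj) (i≢j ∘ sym)))) λ ())

Symmetric₂ : (G n → G n → Bool) → Set
Symmetric₂ φ = ∀ x y → φ x y ≡ φ y x

SymmetricOutside : ∀ {d} → Subset d → (G n → G n → Fin d → Bool) → Set
SymmetricOutside s v = ∀ i → lookup s i ≡ false → Symmetric₂ (λ x y → v x y i)

LowRelation : ∀ {d} → ℕ → (G n → G n → Fin d → Bool) → Vec Bool d → Set
LowRelation K v c = (∃[ i ] lookup c i ≡ true) × Low K (λ x y → lookup c ∙ v x y)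

abstract
  lowRelation? : ∀ {d} K (v : G n → G n → Fin d → Bool) → Dec (∃ (LowRelation K v))
  lowRelation? K v = ∃? (finite-Vec finite-Bool) λ c → any? (λ i → lookup c i Bool.≟ true) ×-dec low? K _

SymmetricRelation : ∀ {d} → Subset d → (G n → G n → Fin d → Bool) → Vec Bool d → Set
SymmetricRelation s v c = (∃[ i ] lookup c i ≡ true) × (∀ i → lookup s i ≡ false → lookup c i ≡ false) ×
                          Symmetric₂ (λ x y → lookup c ∙ v x y)

abstract
  symmetricRelation? : ∀ {d} (s : Subset d) (v : G n → G n → Fin d → Bool) → Dec (∃ (SymmetricRelation s v))
  symmetricRelation? s v = ∃? (finite-Vec finite-Bool) λ c → any? (λ i → lookup c i Bool.≟ true) ×-dec
    all? (λ i → lookup s i Bool.≟ false →-dec lookup c i Bool.≟ false) ×-dec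
    ∀? finite-G λ x → ∀? finite-G λ y → _ Bool.≟ _

module _ {d} (v : G n → G n → Fin d → Bool) where

  no-lowRelation : ∀ {K} → ¬ ∃ (LowRelation K v) → ∀ c → Low K (λ x y → c ∙ v x y) → ∀ i → c i ≡ false
  no-lowRelation none c low i = ¬-not λ ci → none (tabulate c , (i , trans (lookup∘tabulate c i) ci) ,
    low-cong (λ x y → ∙-cong (λ j → sym (lookup∘tabulate c j)) (λ _ → refl)) low)

  no-symmetricRelation : (s : Subset d) → ¬ ∃ (SymmetricRelation s v) →
    ∀ c → (∀ i → lookup s i ≡ false → c i ≡ false) → (∀ x y → c ∙ v x y ≡ c ∙ v y x) → ∀ i → c i ≡ false
  no-symmetricRelation s none c c-supp c-sym i = ¬-not λ ci → none (tabulate c , (i , trans (lookup∘tabulate c i) ci) ,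
    (λ j sj → trans (lookup∘tabulate c j) (c-supp j sj)) ,
    λ x y → trans (tab x y) (trans (c-sym x y) (sym (tab y x))))
    where
    tab : ∀ x y → lookup (tabulate c) ∙ v x y ≡ c ∙ v x y
    tab x y = ∙-cong (lookup∘tabulate c) (λ _ → refl)

record State (n d : ℕ) : Set where
  field
    v         : G n → G n → Fin d → Bool
    v-lin     : BilinearFamily v
    s         : Subset d
    v-sym     : SymmetricOutside s v
    q         : Form₄ n
    hyp       : Hypotheses q
    expansion : Expansion v (defect q)

-- The K functionals that cut out the right kernel of c ∙ v are killed. Then c ∙ v vanishes
-- identically on the image, the low-rank relation becomes exact, and member i is a combination of
-- the others.
module Elimination {n d} (K : ℕ) (S : State n (suc d)) (c : Fin (suc d) → Bool) (i : Fin (suc d)) (ci : c i ≡ true)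
  (low : Low K (λ x y → c ∙ State.v S x y)) where

  open State S

  R : Annihilator (λ k y → c ∙ v (lookup (proj₁ low) k) y)
  R = annihilator K (λ k y → c ∙ v (lookup (proj₁ low) k) y) (λ k → linearʳ (bilinear-∙ c v-lin) (lookup (proj₁ low) k))

  v′ : G n → G n → Fin d → Bool
  v′ x y = v (P R x) (P R y) ∘ punchIn i

  s′ : Subset d
  s′ = tabulate (lookup s ∘ punchIn i)

  c∙v≡false : ∀ x y → c ∙ v (P R x) (P R y) ≡ false
  c∙v≡false x y = proj₂ low (P R y) (λ k → annihilates R k y) (P R x)

  expansion∘P : Expansion (λ x y → v (P R x) (P R y)) (defect (q ∘₄ P R))
  expansion∘P = expansion-∘ {v = v} {r = defect q} (P R) expansion

  expansion′ : Expansion v′ (defect (q ∘₄ P R))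
  expansion′ = expansion-change (without c i) (λ x y → without-∙ c (v (P R x) (P R y)) i ci (c∙v≡false x y)) expansion∘P

  state : State n d
  state = record
    { v         = v′
    ; v-lin     = λ j → bilinear-∘ (P-additive R) (v-lin (punchIn i j))
    ; s         = s′
    ; v-sym     = λ j s′j x y → v-sym (punchIn i j) (trans (sym (lookup∘tabulate (lookup s ∘ punchIn i) j)) s′j) (P R x) (P R y)
    ; q         = q ∘₄ P R
    ; hyp       = hypotheses-∘ (P-additive R) hyp
    ; expansion = expansion′
    }

  prank : PrankAtMost₄ (q ⊞ State.q state) (K * 4)
  prank = prank-P R (Hypotheses.q-lin hyp)

-- Since cᵢ = 1, the symmetric form c ∙ v can take the place of member i without changing the span.
-- The form `q` is untouched, so the exchange is free, and the marked set shrinks.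
module Promotion {n d} (S : State n d) (c : Fin d → Bool) (i : Fin d) (ci : c i ≡ true)
  (c-supp : ∀ i → lookup (State.s S) i ≡ false → c i ≡ false) (c-sym : Symmetric₂ (λ x y → c ∙ State.v S x y)) where

  open State S

  i∈s : i ∈ s
  i∈s = lookup⇒[]= i s (¬-not λ si → contradiction (trans (sym ci) (c-supp i si)) λ ())

  v′ : G n → G n → Fin d → Bool
  v′ x y = replace c i (v x y)

  v′-lin : BilinearFamily v′
  v′-lin j with i ≟ j
  ... | yes _ = bilinear-∙ c v-lin
  ... | no _  = v-lin j

  v′-sym : SymmetricOutside (s - i) v′
  v′-sym j s-ij x y with i ≟ j | outside-minus s i j s-ij
  ... | yes _  | _         = c-sym x y
  ... | no i≢j | inj₁ i≡j  = contradiction i≡j i≢j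
  ... | no i≢j | inj₂ sj   = v-sym j sj x y

  state : State n d
  state = record
    { v = v′ ; v-lin = v′-lin ; s = s - i ; v-sym = v′-sym ; q = q ; hyp = hyp
    ; expansion = expansion-change (λ j → replaceRow c (i ≟ j)) (λ x y → replace-∙ c (v x y) i ci) expansion }

  smaller : ∣ State.s state ∣ < ∣ s ∣
  smaller = x∈p⇒∣p-x∣<∣p∣ i∈s

-- An elimination costs 4K, and η costs 3 for each form that survives; charging both to every form
-- gives a bound linear in the number of forms.
cost : ℕ → ℕ
cost K = K * 4 + 3

-- A relation of low rank removes one of the forms; otherwise a symmetric combination
-- replaces a form outside the symmetric part, which can happen at most u times.
approximate-suc : ∀ K d u → 6 * suc d ≤ K → (∀ (S : State n d) → Approximable (State.q S) (d * cost K)) →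
                  (S : State n (suc d)) → ∣ State.s S ∣ ≤ u → Approximable (State.q S) (suc d * cost K)
approximate-suc K d u 6d≤K rec S s≤u with lowRelation? K (State.v S) | symmetricRelation? (State.s S) (State.v S)
approximate-suc K d u 6d≤K rec S s≤u | yes (c , (i , ci) , low) | _ =
  approximable-≤ (ℕ.+-monoˡ-≤ (d * cost K) (ℕ.m≤m+n (K * 4) 3))
    (approximable-trans (State.q S) (State.q E.state) E.prank (rec E.state))
  where module E = Elimination K S (lookup c) i ci low
approximate-suc K d zero 6d≤K rec S s≤u | no _ | yes (c , (i , ci) , c-supp , c-sym) =
  contradiction (ℕ.≤-trans (Promotion.smaller S (lookup c) i ci c-supp c-sym) s≤u) λ ()
approximate-suc K d (suc u) 6d≤K rec S s≤u | no _ | yes (c , (i , ci) , c-supp , c-sym) =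
  approximate-suc K d u 6d≤K rec P.state (ℕ.≤-pred (ℕ.≤-trans P.smaller s≤u))
  where module P = Promotion S (lookup c) i ci c-supp c-sym
approximate-suc K d u 6d≤K rec S s≤u | no independent | no asymmetric =
  approximable-≤ (ℕ.≤-trans (ℕ.*-monoˡ-≤ (suc d) (ℕ.m≤n+m 3 (K * 4))) (ℕ.≤-reflexive (ℕ.*-comm (cost K) (suc d))))
    (Independent.approximation 6d≤K v v-lin s v-sym (no-lowRelation v independent) (no-symmetricRelation v s asymmetric) q hyp expansion)
  where open State S

approximate : ∀ K d → 6 * d ≤ K → (S : State n d) → Approximable (State.q S) (d * cost K)
approximate K zero    6d≤K S =
  Independent.approximation 6d≤K v v-lin s v-sym (λ c _ ()) (λ c _ _ ()) q hyp expansion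
  where open State S
approximate K (suc d) 6d≤K S =
  -- `K` keeps its value as d falls, so the threshold persists. The marked set has at most as many
  -- elements as there are forms, which bounds the exchanges before the next elimination.
  approximate-suc K d (suc d) 6d≤K (approximate K d (ℕ.≤-trans (ℕ.*-monoʳ-≤ 6 (ℕ.n≤1+n d)) 6d≤K)) S (∣p∣≤n (State.s S))

-- From a decomposition of the defect to a family of bilinear forms

module Symmetrise {n} (q : Form₄ n) (hyp : Hypotheses q) {p} (t : Fin p → SplitProduct n 4)
  (t-sum : ∀ x y z w → defect q x y z w ≡ sum₂ (λ i → SplitProduct.form (t i) (x ∷ y ∷ z ∷ w ∷ []))) where

  open Shape

  shapes : ∀ i → Shape (curry₄ (SplitProduct.form (t i)))
  shapes i = classify (t i)

  R : Annihilator (λ i → l (shapes i))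
  R = annihilator p _ (λ i → l-lin (shapes i))

  left right : G n → G n → Fin p → Bool
  left  x y i = φ (shapes i) (P R x) (P R y)
  right x y i = ψ (shapes i) (P R x) (P R y)

  -- All first factors precede all second factors, so the i-th product couples the coordinates
  -- `i ↑ˡ p` and `p ↑ʳ i`.
  v : G n → G n → Fin (p + p) → Bool
  v x y = left x y ++ right x y

  v-lin : BilinearFamily v
  v-lin i with splitAt p i
  ... | inj₁ j = bilinear-∘ (P-additive R) (φ-lin (shapes j))
  ... | inj₂ j = bilinear-∘ (P-additive R) (ψ-lin (shapes j))

  arrange-cong : ∀ (pr : Pairing) {φ φ′ ψ ψ′ : G n → G n → Bool} → (∀ x y → φ x y ≡ φ′ x y) → (∀ x y → ψ x y ≡ ψ′ x y) →
                 ∀ x y z w → arrange pr φ ψ x y z w ≡ arrange pr φ′ ψ′ x y z w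
  arrange-cong 12∣34 p q x y z w = cong₂ _∧_ (p x y) (q z w)
  arrange-cong 13∣24 p q x y z w = cong₂ _∧_ (p x z) (q y w)
  arrange-cong 14∣23 p q x y z w = cong₂ _∧_ (p x w) (q y z)

  arrange-∘ : ∀ (pr : Pairing) (φ ψ : G n → G n → Bool) (f : G n → G n) x y z w →
              arrange pr φ ψ (f x) (f y) (f z) (f w) ≡ arrange pr (λ x y → φ (f x) (f y)) (λ x y → ψ (f x) (f y)) x y z w
  arrange-∘ 12∣34 φ ψ f x y z w = refl
  arrange-∘ 13∣24 φ ψ f x y z w = refl
  arrange-∘ 14∣23 φ ψ f x y z w = refl

  term : ∀ i x y z w → arrange (pairing (shapes i)) (λ x y → v x y (i ↑ˡ p)) (λ x y → v x y (p ↑ʳ i)) x y z w ≡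
                       SplitProduct.form (t i) (P R x ∷ P R y ∷ P R z ∷ P R w ∷ [])
  term i x y z w = trans
    (arrange-cong (pairing (shapes i)) (λ x y → lookup-++ˡ (left x y) (right x y) i) (λ x y → lookup-++ʳ (left x y) (right x y) i) x y z w)
    (trans (sym (arrange-∘ (pairing (shapes i)) (φ (shapes i)) (ψ (shapes i)) (P R) x y z w))
      (sym (shape (shapes i) (P R x) (P R y) (P R z) (P R w)
        (annihilates R i x) (annihilates R i y) (annihilates R i z) (annihilates R i w))))

  expansion : Expansion v (defect (q ∘₄ P R))
  expansion = expansion-cong (λ x y z w → sym (t-sum (P R x) (P R y) (P R z) (P R w)))
    (expansion-sum λ i → expansion-cong (term i) (expansion-arrange (pairing (shapes i)) (i ↑ˡ p) (p ↑ʳ i)))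

  state : State n (p + p)
  state = record
    -- Every form starts out marked, since nothing is known yet about its symmetry.
    { v = v ; v-lin = v-lin ; s = ⊤ ; v-sym = λ i si → contradiction (trans (sym ([]=⇒lookup (∈⊤ {x = i}))) si) λ ()
    ; q = q ∘₄ P R ; hyp = hypotheses-∘ (P-additive R) hyp ; expansion = expansion }

  approximation : Approximable q (p * 4 + (p + p) * cost (6 * (p + p)))
  approximation = approximable-trans q (q ∘₄ P R) (prank-P R (Hypotheses.q-lin hyp))
    (approximate (6 * (p + p)) (p + p) ℕ.≤-refl state)

-- Invariance under all permutations

transpositions⇒symmetric : (α : Form n k) → (∀ i j xs → (α ∘ₚ transpose i j) xs ≡ α xs) → Symmetric α
transpositions⇒symmetric {k = k} α α-transpose π _ xs =
  trans (cong α (tabulate-cong (λ i → cong (lookup xs) (sym (eval-decompose π i))))) (go (decompose π) xs)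
  where
  go : (ts : TranspositionList k) → ∀ xs → (α ∘ₚ eval ts) xs ≡ α xs
  go []             xs = cong α (tabulate∘lookup xs)
  go ((i , j) ∷ ts) xs = begin
    α (tabulate λ l → lookup xs (eval ts ⟨$⟩ʳ (transpose i j ⟨$⟩ʳ l)))
      ≡⟨ cong α (tabulate-cong (λ l → sym (lookup∘tabulate (lookup xs ∘ (eval ts ⟨$⟩ʳ_)) (transpose i j ⟨$⟩ʳ l)))) ⟩
    (α ∘ₚ transpose i j) (tabulate λ l → lookup xs (eval ts ⟨$⟩ʳ l))
      ≡⟨ α-transpose i j _ ⟩
    (α ∘ₚ eval ts) xs
      ≡⟨ go ts xs ⟩
    α xs ∎
    where open ≡-Reasoning

module _ {q : Form₄ n} (s₁₂ : ∀ x y z w → q x y z w ≡ q y x z w) (s₂₃ : ∀ x y z w → q x y z w ≡ q x z y w)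
         (s₃₄ : ∀ x y z w → q x y z w ≡ q x y w z) where

  -- The transpositions that are not adjacent are conjugates of adjacent ones, such as (1 3) = (1
  -- 2)(2 3)(1 2).
  form₄-symmetric : Symmetric (form₄ q)
  form₄-symmetric = transpositions⇒symmetric (form₄ q) λ { i j (x ∷ y ∷ z ∷ w ∷ []) → go i j x y z w }
    where
    s₁₃ : ∀ x y z w → q z y x w ≡ q x y z w
    s₁₃ x y z w = trans (s₁₂ z y x w) (trans (s₂₃ y z x w) (s₁₂ y x z w))
    s₂₄ : ∀ x y z w → q x w z y ≡ q x y z w
    s₂₄ x y z w = trans (s₂₃ x w z y) (trans (s₃₄ x z w y) (s₂₃ x z y w))
    s₁₄ : ∀ x y z w → q w y z x ≡ q x y z w
    s₁₄ x y z w = trans (s₁₂ w y z x) (trans (s₂₄ y x z w) (s₁₂ y x z w))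
    go : ∀ i j x y z w → (form₄ q ∘ₚ transpose i j) (x ∷ y ∷ z ∷ w ∷ []) ≡ q x y z w
    go zero                   zero                   x y z w = refl
    go zero                   (suc zero)             x y z w = s₁₂ y x z w
    go zero                   (suc (suc zero))       x y z w = s₁₃ x y z w
    go zero                   (suc (suc (suc zero))) x y z w = s₁₄ x y z w
    go (suc zero)             zero                   x y z w = s₁₂ y x z w
    go (suc zero)             (suc zero)             x y z w = refl
    go (suc zero)             (suc (suc zero))       x y z w = s₂₃ x z y w
    go (suc zero)             (suc (suc (suc zero))) x y z w = s₂₄ x y z w
    go (suc (suc zero))       zero                   x y z w = s₁₃ x y z w
    go (suc (suc zero))       (suc zero)             x y z w = s₂₃ x z y w
    go (suc (suc zero))       (suc (suc zero))       x y z w = refl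
    go (suc (suc zero))       (suc (suc (suc zero))) x y z w = s₃₄ x y w z
    go (suc (suc (suc zero))) zero                   x y z w = s₁₄ x y z w
    go (suc (suc (suc zero))) (suc zero)             x y z w = s₂₄ x y z w
    go (suc (suc (suc zero))) (suc (suc zero))       x y z w = s₃₄ x y w z
    go (suc (suc (suc zero))) (suc (suc (suc zero))) x y z w = refl

-- The theorem for uncurried forms

hypotheses : {α : Form n 4} → Multilinear α → SymmetricIn (inside ∷ inside ∷ inside ∷ outside ∷ []) α →
             (∀ u x₃ x₄ → α (u ∷ u ∷ x₃ ∷ x₄ ∷ []) ≡ 0₂) → Hypotheses (curry₄ α)
hypotheses {α = α} α-lin α-sym α-alt = record
  { q-lin       = curry₄-quadrilinear α-lin
  ; sym₁₂       = λ x y z w → sym (α-sym (transpose (# 0) (# 1)) (λ where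
      zero i∉                    → contradiction here i∉
      (suc zero) i∉              → contradiction (there here) i∉
      (suc (suc zero)) _         → refl
      (suc (suc (suc zero))) _   → refl) (x ∷ y ∷ z ∷ w ∷ []))
  ; sym₂₃       = λ x y z w → sym (α-sym (transpose (# 1) (# 2)) (λ where
      zero _                     → refl
      (suc zero) i∉              → contradiction (there here) i∉
      (suc (suc zero)) i∉        → contradiction (there (there here)) i∉
      (suc (suc (suc zero))) _   → refl) (x ∷ y ∷ z ∷ w ∷ []))
  ; alternating = α-alt
  }

theorem8 : Σ[ A ∈ ℚ ] A ℚ.> 0ℚ ×
    (∀ (n r : ℕ) → r > 0 → (α : Form n 4) → Multilinear α →
    SymmetricIn (inside ∷ inside ∷ inside ∷ outside ∷ []) α →
    (∀ u x₃ x₄ → α (u ∷ u ∷ x₃ ∷ x₄ ∷ []) ≡ 0₂) →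
    (∃[ p ] IsPrank (α ⊕ α ∘ₚ transpose (# 2) (# 3)) p × p ≤ r) →
    Σ[ α′ ∈ Form n 4 ] Multilinear α′ × Symmetric α′ ×
    (∃[ p ] IsPrank (α ⊕ α′) p ×
    fromℕ p ≤ℝ exp (exp (const (A ℚ.* fromℕ r)))))
theorem8 = fromℕ 16 , ℚ.positive⁻¹ (fromℕ 16) , λ n r r>0 α α-lin α-sym α-alt (p , ((t , t-sum) , _) , p≤r) →
  let open Approximable (Symmetrise.approximation (curry₄ α) (hypotheses α-lin α-sym α-alt) t
                          (λ x y z w → t-sum (x ∷ y ∷ z ∷ w ∷ [])))
      p′ , isPrank , p′≤ = prank-exists (prank-cong {β = α ⊕ form₄ q′} (λ { (x ∷ y ∷ z ∷ w ∷ []) → refl }) prank)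
  in form₄ q′ , form₄-multilinear q′-lin , form₄-symmetric q′₁₂ q′₂₃ q′₃₄ ,
     p′ , isPrank , quadratic≤exp-exp r (ℕ.≤-trans p′≤ (bound r>0 p≤r))
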